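{- For $n\ge0$ define $$P_n=\sum_{\sigma\in\mathfrak{D}_{2n}} x_1^{\mathrm{eareccpeak}(\sigma)}x_2^{\mathrm{eareccdfall}(\sigma)}y_1^{\mathrm{ereccval}(\sigma)}y_2^{\mathrm{ereccdrise}(\sigma)}u_1^{\mathrm{nrcpeak}(\sigma)}u_2^{\mathrm{nrcdfall}(\sigma)}v_1^{\mathrm{nrcval}(\sigma)}v_2^{\mathrm{nrcdrise}(\sigma)}w_{\mathrm e}^{\mathrm{evennrfix}(\sigma)}w_{\mathrm o}^{\mathrm{oddnrfix}(\sigma)}z_{\mathrm e}^{\mathrm{evenrar}(\sigma)}z_{\mathrm o}^{\mathrm{oddrar}(\sigma)}$$ $$\times\,p_{ -1}^{\mathrm{lcrosscpeak}(\sigma)}p_{ -2}^{\mathrm{lcrosscdfall}(\sigma)}p_{+1}^{\mathrm{ucrosscval}(\sigma)}p_{+2}^{\mathrm{ucrosscdrise}(\sigma)}q_{ -1}^{\mathrm{lnestcpeak}(\sigma)}q_{ -2}^{\mathrm{lnestcdfall}(\sigma)}q_{+1}^{\mathrm{unestcval}(\sigma)}q_{+2}^{\mathrm{unestcdrise}(\sigma)}s_{\mathrm e}^{\mathrm{epsnest}(\sigma)}s_{\mathrm o}^{\mathrm{opsnest}(\sigma)},$$ a polynomial in 22 variables. Then $\sum_{n\ge0}P_nt^n$ equals, as formal power series in $t$, the T-type continued fraction with coefficients $\alpha_{2k-1}=\bigl(p_{ -1}^{k-1}x_1+q_{ -1}[k-1]_{p_{ -1},q_{ -1}}u_1\bigr)\bigl(p_{+1}^{k-1}y_1+q_{+1}[k-1]_{p_{+1},q_{+1}}v_1\bigr)$,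 $\alpha_{2k}=\bigl(p_{ -2}^{k-1}x_2+q_{ -2}[k-1]_{p_{ -2},q_{ -2}}u_2+s_{\mathrm e}^kw_{\mathrm e}\bigr)\bigl(p_{+2}^{k-1}y_2+q_{+2}[k-1]_{p_{+2},q_{+2}}v_2+s_{\mathrm o}^kw_{\mathrm o}\bigr)$ for $k\ge1$, $\delta_1=z_{\mathrm e}z_{\mathrm o}$, $\delta_n=0$ for $n\ge2$.
   Context: For $n\ge0$, $\mathfrak{D}_{2n}$ is the set of permutations $\sigma$ of $[2n]$ with $\sigma(2k-1)\ge 2k-1$ and $\sigma(2k)\le 2k$ for all $k\in[n]$ (D-permutations). For an index $i$: cycle peak if $\sigma^{ -1}(i)<i>\sigma(i)$, cycle valley if $\sigma^{ -1}(i)>i<\sigma(i)$, cycle double rise if $\sigma^{ -1}(i)<i<\sigma(i)$, cycle double fall if $\sigma^{ -1}(i)>i>\sigma(i)$, fixed point if $\sigma(i)=i$. $i$ is a record if $\sigma(j)<\sigma(i)$ for all $j<i$, an antirecord if $\sigma(j)>\sigma(i)$ for all $j>i$; exclusive record = record but not antirecord; exclusive antirecord = antirecord but not record; record-antirecord = both; neither-record-antirecord = neither. $\mathrm{eareccpeak},\mathrm{eareccdfall}$ count exclusive antirecords that are cycle peaks, resp. cycle double falls; $\mathrm{ereccval},\mathrm{ereccdrise}$ count exclusive records that are cycle valleys, resp. cycle double rises; $\mathrm{nrcpeak},\mathrm{nrcdfall},\mathrm{nrcval},\mathrm{nrcdrise}$ count neither-record-antirecords that are cycle peaks, cycle double falls,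 cycle valleys, cycle double rises; $\mathrm{evennrfix},\mathrm{oddnrfix}$ count even/odd fixed points that are neither-record-antirecords; $\mathrm{evenrar},\mathrm{oddrar}$ count even/odd record-antirecords. Index-refined statistics: $\mathrm{ucross}(j,\sigma)=\#\{(i,k,l):i<j<k<l,\ k=\sigma(i),\ l=\sigma(j)\}$, $\mathrm{unest}(j,\sigma)=\#\{(i,k,l):i<j<k<l,\ k=\sigma(j),\ l=\sigma(i)\}$, $\mathrm{lcross}(k,\sigma)=\#\{(i,j,l):i<j<k<l,\ i=\sigma(k),\ j=\sigma(l)\}$, $\mathrm{lnest}(k,\sigma)=\#\{(i,j,l):i<j<k<l,\ i=\sigma(l),\ j=\sigma(k)\}$, and for a fixed point $j$, $\mathrm{psnest}(j,\sigma)=\#\{i<j:\sigma(i)>j\}$. Then $\mathrm{ucrosscval}(\sigma)=\sum_{j\text{ cycle valley}}\mathrm{ucross}(j,\sigma)$, $\mathrm{ucrosscdrise}(\sigma)=\sum_{j\text{ cycle double rise}}\mathrm{ucross}(j,\sigma)$, $\mathrm{lcrosscpeak}(\sigma)=\sum_{k\text{ cycle peak}}\mathrm{lcross}(k,\sigma)$, $\mathrm{lcrosscdfall}(\sigma)=\sum_{k\text{ cycle double fall}}\mathrm{lcross}(k,\sigma)$, and analogously $\mathrm{unestcval},\mathrm{unestcdrise},\mathrm{lnestcpeak},\mathrm{lnestcdfall}$ with unest/lnest; $\mathrm{epsnest}(\sigma)$ (resp. $\mathrm{opsnest}(\sigma)$) is the sum of $\mathrm{psnest}(i,\sigma)$ over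 even (resp. odd) fixed points $i$. For $n\ge0$, $[n]_{p,q}=\sum_{j=0}^{n-1}p^jq^{n-1-j}$ (so $[0]_{p,q}=0$). The T-type continued fraction with coefficients $(\alpha_n)_{n\ge1},(\delta_n)_{n\ge1}$ is the formal power series $1/(1-\delta_1t-\alpha_1t/(1-\delta_2t-\alpha_2t/(1-\delta_3t-\cdots)))$. -}

module Defs where

open import Data.Nat.Base using (ℕ; zero; suc; _∸_; _≡ᵇ_; _<ᵇ_; _≤ᵇ_; ⌊_/2⌋)
open import Data.Bool.Base using (Bool; true; false; _∧_; _∨_; not; if_then_else_)
open import Data.List.Base using (List; []; _∷_; map; concatMap)
open import Algebra.Bundles using (CommutativeRing)
import Data.Nat.Base as ℕ

-- Generic finite helpers on ℕ (indices are 0-based: index i stands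
-- for the element i+1 of [m]).

count : ℕ → (ℕ → Bool) → ℕ
count zero    p = 0
count (suc m) p = count m p ℕ.+ (if p m then 1 else 0)

sumN : ℕ → (ℕ → ℕ) → ℕ
sumN zero    g = 0
sumN (suc m) g = sumN m g ℕ.+ g m

allB : ℕ → (ℕ → Bool) → Bool
allB zero    p = true
allB (suc m) p = allB m p ∧ p m

anyB : ℕ → (ℕ → Bool) → Bool
anyB zero    p = false
anyB (suc m) p = anyB m p ∨ p m

isEven : ℕ → Bool
isEven zero          = true
isEven (suc zero)    = false
isEven (suc (suc n)) = isEven n

range : ℕ → List ℕ
range zero    = []
range (suc m) = m ∷ range m

allLists : ℕ → ℕ → List (List ℕ)
allLists zero    m = [] ∷ []
allLists (suc k) m = concatMap (λ a → map (a ∷_) (allLists k m)) (range m)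

at : List ℕ → ℕ → ℕ
at []       _       = 0
at (a ∷ l)  zero    = a
at (a ∷ l)  (suc i) = at l i

-- D-permutations of [m] (m = 2n), given as the list (σ(1)-1,…,σ(m)-1).

module Perm (m : ℕ) (f : ℕ → ℕ) where

  isPerm : Bool
  isPerm = allB m (λ i → f i <ᵇ m) ∧ allB m (λ i → allB i (λ j → not (f i ≡ᵇ f j)))

  -- 0-based index i even  ⇔  1-based index i+1 odd
  isD : Bool
  isD = isPerm ∧ allB m (λ i → if isEven i then i ≤ᵇ f i else f i ≤ᵇ i)

  invLt invGt : ℕ → Bool
  invLt i = anyB m (λ j → (f j ≡ᵇ i) ∧ (j <ᵇ i))
  invGt i = anyB m (λ j → (f j ≡ᵇ i) ∧ (i <ᵇ j))

  cpeak cval cdrise cdfall fix : ℕ → Bool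
  cpeak  i = invLt i ∧ (f i <ᵇ i)
  cval   i = invGt i ∧ (i <ᵇ f i)
  cdrise i = invLt i ∧ (i <ᵇ f i)
  cdfall i = invGt i ∧ (f i <ᵇ i)
  fix    i = f i ≡ᵇ i

  rec arec : ℕ → Bool
  rec  i = allB i (λ j → f j <ᵇ f i)
  arec i = allB m (λ j → (j ≤ᵇ i) ∨ (f i <ᵇ f j))

  erec earec rar nr : ℕ → Bool
  erec  i = rec i ∧ not (arec i)
  earec i = arec i ∧ not (rec i)
  rar   i = rec i ∧ arec i
  nr    i = not (rec i) ∧ not (arec i)

  -- 1-based parity of the index i+1
  evenIdx oddIdx : ℕ → Bool
  evenIdx i = not (isEven i)
  oddIdx  i = isEven i

  ucross unest lcross lnest psnest : ℕ → ℕ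
  ucross j = count j (λ i → (j <ᵇ f i) ∧ (f i <ᵇ f j))
  unest  j = count j (λ i → (j <ᵇ f j) ∧ (f j <ᵇ f i))
  lcross k = count m (λ l → (k <ᵇ l) ∧ ((f k <ᵇ f l) ∧ (f l <ᵇ k)))
  lnest  k = count m (λ l → (k <ᵇ l) ∧ ((f l <ᵇ f k) ∧ (f k <ᵇ k)))
  psnest j = count j (λ i → j <ᵇ f i)

  sumOver : (ℕ → Bool) → (ℕ → ℕ) → ℕ
  sumOver p g = sumN m (λ i → if p i then g i else 0)

  eareccpeak eareccdfall ereccval ereccdrise : ℕ
  eareccpeak  = count m (λ i → earec i ∧ cpeak i)
  eareccdfall = count m (λ i → earec i ∧ cdfall i)
  ereccval    = count m (λ i → erec i ∧ cval i)
  ereccdrise  = count m (λ i → erec i ∧ cdrise i)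

  nrcpeak nrcdfall nrcval nrcdrise : ℕ
  nrcpeak  = count m (λ i → nr i ∧ cpeak i)
  nrcdfall = count m (λ i → nr i ∧ cdfall i)
  nrcval   = count m (λ i → nr i ∧ cval i)
  nrcdrise = count m (λ i → nr i ∧ cdrise i)

  evennrfix oddnrfix evenrar oddrar : ℕ
  evennrfix = count m (λ i → evenIdx i ∧ (fix i ∧ nr i))
  oddnrfix  = count m (λ i → oddIdx i ∧ (fix i ∧ nr i))
  evenrar   = count m (λ i → evenIdx i ∧ rar i)
  oddrar    = count m (λ i → oddIdx i ∧ rar i)

  lcrosscpeak lcrosscdfall ucrosscval ucrosscdrise : ℕ
  lcrosscpeak  = sumOver cpeak lcross
  lcrosscdfall = sumOver cdfall lcross
  ucrosscval   = sumOver cval ucross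
  ucrosscdrise = sumOver cdrise ucross

  lnestcpeak lnestcdfall unestcval unestcdrise : ℕ
  lnestcpeak  = sumOver cpeak lnest
  lnestcdfall = sumOver cdfall lnest
  unestcval   = sumOver cval unest
  unestcdrise = sumOver cdrise unest

  epsnest opsnest : ℕ
  epsnest = sumOver (λ i → evenIdx i ∧ fix i) psnest
  opsnest = sumOver (λ i → oddIdx i ∧ fix i) psnest

-- The 22 indeterminates, specialised to elements of a commutative ring.

record Vars {c ℓ} (R : CommutativeRing c ℓ) : Set c where
  open CommutativeRing R using (Carrier)
  field
    x₁ x₂ y₁ y₂ u₁ u₂ v₁ v₂ wₑ wₒ zₑ zₒ : Carrier
    p₋₁ p₋₂ p₊₁ p₊₂ q₋₁ q₋₂ q₊₁ q₊₂ sₑ sₒ : Carrier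

module _ {c ℓ} (R : CommutativeRing c ℓ) where
  open CommutativeRing R

  pow : Carrier → ℕ → Carrier
  pow x zero    = 1#
  pow x (suc n) = x * pow x n

  sumR : ℕ → (ℕ → Carrier) → Carrier
  sumR zero    g = 0#
  sumR (suc k) g = sumR k g + g k

  sumList : List Carrier → Carrier
  sumList []       = 0#
  sumList (a ∷ as) = a + sumList as

  qint : Carrier → Carrier → ℕ → Carrier
  qint p q k = sumR k (λ j → pow p j * pow q (k ∸ 1 ∸ j))

  weight : Vars R → ℕ → (ℕ → ℕ) → Carrier
  weight v m f =
      pow x₁ eareccpeak * pow x₂ eareccdfall * pow y₁ ereccval * pow y₂ ereccdrise
    * pow u₁ nrcpeak * pow u₂ nrcdfall * pow v₁ nrcval * pow v₂ nrcdrise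
    * pow wₑ evennrfix * pow wₒ oddnrfix * pow zₑ evenrar * pow zₒ oddrar
    * pow p₋₁ lcrosscpeak * pow p₋₂ lcrosscdfall * pow p₊₁ ucrosscval * pow p₊₂ ucrosscdrise
    * pow q₋₁ lnestcpeak * pow q₋₂ lnestcdfall * pow q₊₁ unestcval * pow q₊₂ unestcdrise
    * pow sₑ epsnest * pow sₒ opsnest
    where open Vars v
          open Perm m f

  P : Vars R → ℕ → Carrier
  P v n = sumList (map (λ l → if Perm.isD (n ℕ.+ n) (at l) then weight v (n ℕ.+ n) (at l) else 0#)
                       (allLists (n ℕ.+ n) (n ℕ.+ n)))

  -- continued fraction coefficients, α_k and δ_k for k ≥ 1 (index 0 unused)
  αodd αeven : Vars R → ℕ → Carrier   -- argument is k-1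
  αodd v k′ = (pow p₋₁ k′ * x₁ + q₋₁ * qint p₋₁ q₋₁ k′ * u₁)
            * (pow p₊₁ k′ * y₁ + q₊₁ * qint p₊₁ q₊₁ k′ * v₁)
    where open Vars v
  αeven v k′ = (pow p₋₂ k′ * x₂ + q₋₂ * qint p₋₂ q₋₂ k′ * u₂ + pow sₑ (suc k′) * wₑ)
             * (pow p₊₂ k′ * y₂ + q₊₂ * qint p₊₂ q₊₂ k′ * v₂ + pow sₒ (suc k′) * wₒ)
    where open Vars v

  α : Vars R → ℕ → Carrier
  α v zero    = 0#
  α v (suc m) = if isEven m then αodd v ⌊ m /2⌋ else αeven v ⌊ m /2⌋
  -- α (2k-1) = αodd (k-1) ;  α (2k) = αeven (k-1)

  δ : Vars R → ℕ → Carrier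
  δ v (suc zero) = Vars.zₑ v * Vars.zₒ v
  δ v _          = 0#

  -- T-type continued fraction with coefficients a, d (indexed from 1):
  -- f_k = 1/(1 - d_k t - a_k t f_{k+1}),  result f_1.
  -- tab n k i is the coefficient of t^i in f_k, correct for all i ≤ n,
  -- computed from f_k = 1 + d_k t f_k + a_k t f_{k+1} f_k.
  tab : (ℕ → Carrier) → (ℕ → Carrier) → ℕ → ℕ → ℕ → Carrier
  tab a d zero    k i = 1#
  tab a d (suc n) k i =
    if i ≤ᵇ n then tab a d n k i
    else (d k * tab a d n k n
          + a k * sumR (suc n) (λ j → tab a d n (suc k) j * tab a d n k (n ∸ j)))

  Tfrac : (ℕ → Carrier) → (ℕ → Carrier) → ℕ → Carrier
  Tfrac a d n = tab a d n 1 n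

{-# OPTIONS --safe #-}

-- A D-permutation σ maps the positions 2k-1 weakly upwards and the positions 2k weakly downwards.
-- Let A be the set of values taken at the positions 2k-1. For fixed A the upward part of σ is built
-- from right to left and the downward part from left to right; at each position only the number of
-- values still available matters, and if the chosen value has rank r among them, then r and its
-- complement are, up to the choice of a fixed point, the crossings and nestings of the position.
-- Hence the sum over σ with given A is a product of factors [k] over the positions, and its
-- factors are step weights of the lattice path that goes down at the elements of A and up
-- elsewhere. Cutting these paths at their first descent gives the recurrence of the T-fraction;
-- the path dips below its starting level only at record-antirecords, which yields δ₁.

module Submission where

open import Defs
open import Algebra.Bundles using (CommutativeRing)
open import Data.Nat.Base as ℕ using (ℕ; zero; suc; pred; _∸_; _≡ᵇ_; _<ᵇ_; _≤ᵇ_; _≤_; _<_; z≤n; s≤s; ⌊_/2⌋)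
open import Data.Nat.Properties as ℕₚ using
  (m<n⇒m<1+n; n<1+n; m<1+n⇒m<n∨m≡n; ≡ᵇ⇒≡; ≡⇒≡ᵇ; <ᵇ⇒<; <⇒<ᵇ; ≤ᵇ⇒≤; ≤⇒≤ᵇ; <⇒≢; <⇒≱; ≤-refl; ≤∧≢⇒<; m≤n⇒m<n∨m≡n;
   ∸-+-assoc; +-∸-assoc; m∸n≤m; n∸n≡0; m+n∸m≡n; m+n∸n≡m; pred[m∸n]≡m∸[1+n]; <-cmp; _≟_)
open import Data.Bool.Base using (Bool; true; false; _∧_; not; if_then_else_; T)
open import Data.Bool.Properties using (T-∧; T-∨; T?; ∧-assoc; ∧-zeroʳ; ∧-identityʳ)
open import Data.List.Base using (List; []; _∷_; _++_; map; concatMap; foldl; drop)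
open import Data.List.Properties using (map-++; map-∘)
open import Data.List.Membership.Propositional using (_∈_; _∉_)
open import Data.List.Relation.Unary.All as All using (All; []; _∷_)
import Data.List.Relation.Unary.All.Properties as Allₚ
open import Data.List.Relation.Unary.Any using (here; there)
open import Data.List.Relation.Unary.AllPairs using (AllPairs; []; _∷_)
import Data.List.Relation.Unary.AllPairs.Properties as AllPairsₚ
open import Data.List.Relation.Binary.Permutation.Propositional as ↭ using (_↭_; prep; swap; ↭-trans; ↭-refl; ↭-sym)
import Data.List.Relation.Binary.Permutation.Propositional.Properties as ↭ₚ
open import Data.Product.Base using (∃; _×_; _,_; proj₁; proj₂)
open import Data.Sum.Base using (_⊎_; inj₁; inj₂)
open import Data.Empty using (⊥-elim)
open import Data.Unit.Base using (tt)
open import Function.Base using (_∘_; const)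
open import Function.Bundles using (Equivalence)
open import Relation.Binary.Definitions using (Tri; tri<; tri≈; tri>)
open import Relation.Nullary using (¬_; yes; no)
open import Relation.Nullary.Decidable using (decidable-stable)
open import Relation.Binary.PropositionalEquality as ≡ using (_≡_; _≢_; _≗_; cong; cong₂; subst)

-- Indices start at 0, so the rising positions are the even ones. The obstacle is that `A` depends
-- on the permutation and that each value restricts the others, so the sum does not factor as it
-- stands. At most one `A` survives for each `f`, and none unless `f` is a D-permutation; hence both
-- sums run freely and can be exchanged. The filling order is dictated by nesting: it makes the
-- eligible sets of one side grow, so every value already used on that side is lost to the next
-- position, and the number of values left is known in advance. Heights are shifted up by one
-- because a walk may dip once below its start. At height 0 the down weight is an empty sum, which
-- stops the walk and also makes truncated subtraction harmless. Two steps carry one power of t, so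
-- the dip 1, 0, 1 is a single term in t: this is why it enters as a level coefficient δ₁ rather
-- than as an α.

-- Counting with Boolean predicates, finite permutations, parity

module Counting where
  open import Data.Nat.Base using (_+_)
  open import Data.Nat.Properties
  open import Relation.Binary.PropositionalEquality

  T-iff : ∀ {a b} → (T a → T b) → (T b → T a) → a ≡ b
  T-iff {false} {false} f g = refl
  T-iff {false} {true}  f g = ⊥-elim (g tt)
  T-iff {true}  {false} f g = ⊥-elim (f tt)
  T-iff {true}  {true}  f g = refl

  T⇒≡true : ∀ {b} → T b → b ≡ true
  T⇒≡true {true} _ = refl

  ¬T⇒≡false : ∀ {b} → ¬ T b → b ≡ false
  ¬T⇒≡false {false} _ = refl
  ¬T⇒≡false {true} ¬t = ⊥-elim (¬t tt)

  ≡true⇒T : ∀ {b} → b ≡ true → T b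
  ≡true⇒T refl = tt

  ≡false⇒¬T : ∀ {b} → b ≡ false → ¬ T b
  ≡false⇒¬T refl ()

  <ᵇ-false : ∀ m n → (m <ᵇ n) ≡ false → n ≤ m
  <ᵇ-false m n e = ≮⇒≥ λ m<n → ≡false⇒¬T e (<⇒<ᵇ m<n)

  infixr 4 _&_
  _&_ : ∀ {a b} → T a → T b → T (a ∧ b)
  _&_ {true} {true} _ _ = tt

  ∧ˡ : ∀ {a b} → T (a ∧ b) → T a
  ∧ˡ = proj₁ ∘ Equivalence.to T-∧

  ∧ʳ : ∀ {a b} → T (a ∧ b) → T b
  ∧ʳ {a} = proj₂ ∘ Equivalence.to (T-∧ {a})

  T-not⁺ : ∀ {b} → ¬ T b → T (not b)
  T-not⁺ {false} _ = tt
  T-not⁺ {true} ¬t = ¬t tt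

  T-not⁻ : ∀ {b} → T (not b) → ¬ T b
  T-not⁻ {false} _ ()

  allB⁺ : ∀ k {p} → (∀ {i} → i < k → T (p i)) → T (allB k p)
  allB⁺ zero    h = tt
  allB⁺ (suc k) h = allB⁺ k (λ i<k → h (m<n⇒m<1+n i<k)) & h (n<1+n k)

  allB⁻ : ∀ k {p} → T (allB k p) → ∀ {i} → i < k → T (p i)
  allB⁻ (suc k) {p} h {i} i<1+k with m<1+n⇒m<n∨m≡n i<1+k
  ... | inj₁ i<k  = allB⁻ k (∧ˡ h) i<k
  ... | inj₂ refl = ∧ʳ {allB k p} h

  anyB⁺ : ∀ k {p i} → i < k → T (p i) → T (anyB k p)
  anyB⁺ (suc k) {p} i<1+k t with m<1+n⇒m<n∨m≡n i<1+k
  ... | inj₁ i<k  = Equivalence.from T-∨ (inj₁ (anyB⁺ k i<k t))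
  ... | inj₂ refl = Equivalence.from (T-∨ {anyB k p}) (inj₂ t)

  anyB⁻ : ∀ k {p} → T (anyB k p) → ∃ λ i → i < k × T (p i)
  anyB⁻ (suc k) {p} t with Equivalence.to (T-∨ {anyB k p}) t
  ... | inj₁ t′ = let i , i<k , q = anyB⁻ k t′ in i , m<n⇒m<1+n i<k , q
  ... | inj₂ t′ = k , n<1+n k , t′

  allB-cong : ∀ k {p q} → (∀ {i} → i < k → p i ≡ q i) → allB k p ≡ allB k q
  allB-cong zero    h = refl
  allB-cong (suc k) h = cong₂ _∧_ (allB-cong k (h ∘ m<n⇒m<1+n)) (h (n<1+n k))

  ⟦_⟧ : Bool → ℕ
  ⟦ b ⟧ = if b then 1 else 0

  count-cong : ∀ k {p q} → (∀ {i} → i < k → p i ≡ q i) → count k p ≡ count k q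
  count-cong zero    h = refl
  count-cong (suc k) h = cong₂ _+_ (count-cong k (h ∘ m<n⇒m<1+n)) (cong ⟦_⟧ (h (n<1+n k)))

  count-+ : ∀ k {p q r} → (∀ {i} → i < k → ⟦ p i ⟧ ≡ ⟦ q i ⟧ + ⟦ r i ⟧) →
            count k p ≡ count k q + count k r
  count-+ zero    h = refl
  count-+ (suc k) {p} {q} {r} h
    rewrite count-+ k {p} {q} {r} (h ∘ m<n⇒m<1+n) | h (n<1+n k) =
    +-interchange (count k q) (count k r) ⟦ q k ⟧ ⟦ r k ⟧
    where
    open import Algebra.Properties.CommutativeSemigroup +-commutativeSemigroup
      using () renaming (interchange to +-interchange)

  count-true : ∀ k → count k (const true) ≡ k
  count-true zero    = refl
  count-true (suc k) = trans (cong (_+ 1) (count-true k)) (+-comm k 1)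

  count≡0⁺ : ∀ k {p} → (∀ {i} → i < k → ¬ T (p i)) → count k p ≡ 0
  count≡0⁺ zero    h = refl
  count≡0⁺ (suc k) h
    rewrite count≡0⁺ k (h ∘ m<n⇒m<1+n) | ¬T⇒≡false (h (n<1+n k)) = refl

  count≡0⁻ : ∀ k {p} → count k p ≡ 0 → ∀ {i} → i < k → ¬ T (p i)
  count≡0⁻ (suc k) {p} e i<1+k t with m<1+n⇒m<n∨m≡n i<1+k
  ... | inj₁ i<k  = count≡0⁻ k (m+n≡0⇒m≡0 _ e) i<k t
  ... | inj₂ refl with p k | m+n≡0⇒n≡0 (count k p) e
  ...   | true | ()

  count-prefix : ∀ {k m} p → k ≤ m → count m (λ i → (i <ᵇ k) ∧ p i) ≡ count k p
  count-prefix {k} {zero}  p z≤n = refl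
  count-prefix {k} {suc m} p k≤1+m with m≤n⇒m<n∨m≡n k≤1+m
  ... | inj₂ refl = count-cong (suc m) λ {i} i<k → cong (_∧ p i) (T⇒≡true (<⇒<ᵇ i<k))
  ... | inj₁ (s≤s k≤m)
    rewrite count-prefix {k} {m} p k≤m
          | ¬T⇒≡false {m <ᵇ k} (λ t → ≤⇒≯ k≤m (<ᵇ⇒< m k t)) = +-identityʳ _

  count-remove : ∀ k Q {x} → x < k → count k Q ≡ count k (λ v → Q v ∧ not (x ≡ᵇ v)) + ⟦ Q x ⟧
  count-remove (suc k) Q {x} x<1+k with m<1+n⇒m<n∨m≡n x<1+k
  ... | inj₁ x<k
    rewrite count-remove k Q x<k
          | ¬T⇒≡false {x ≡ᵇ k} (λ t → <⇒≢ x<k (≡ᵇ⇒≡ x k t)) | ∧-identityʳ (Q k)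
    = trans (+-assoc c _ _) (trans (cong (c +_) (+-comm ⟦ Q x ⟧ _)) (sym (+-assoc c _ _)))
    where c = count k (λ v → Q v ∧ not (x ≡ᵇ v))
  ... | inj₂ refl
    rewrite T⇒≡true (≡⇒≡ᵇ k k refl) | ∧-zeroʳ (Q k)
          | +-identityʳ (count k (λ v → Q v ∧ not (k ≡ᵇ v))) =
    cong (_+ ⟦ Q k ⟧) (count-cong k λ {i} i<k → sym (trans
      (cong (λ b → Q i ∧ not b) (¬T⇒≡false λ t → <⇒≢ i<k (sym (≡ᵇ⇒≡ k i t))))
      (∧-identityʳ (Q i))))

  InjectiveOn : ℕ → (ℕ → Bool) → (ℕ → ℕ) → Set
  InjectiveOn k D f = ∀ {i j} → i < k → j < k → T (D i) → T (D j) → f i ≡ f j → i ≡ j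

  unhit : ℕ → (ℕ → Bool) → (ℕ → ℕ) → ℕ → Bool
  unhit k D f v = allB k (λ j → not (D j ∧ (f j ≡ᵇ v)))

  unhit⁺ : ∀ k {D f v} → (∀ {j} → j < k → T (D j) → f j ≢ v) → T (unhit k D f v)
  unhit⁺ k {D} {f} {v} h = allB⁺ k λ {j} j<k → T-not⁺ λ t → h j<k (∧ˡ t) (≡ᵇ⇒≡ (f j) v (∧ʳ {D j} t))

  unhit⁻ : ∀ k {D f v} → T (unhit k D f v) → ∀ {j} → j < k → T (D j) → f j ≢ v
  unhit⁻ k {f = f} {v} h {j} j<k d e = T-not⁻ (allB⁻ k h j<k) (d & ≡⇒≡ᵇ (f j) v e)

  -- Induction on `k` removes one value at a time. By injectivity the value `f k` has not been
  -- removed before, so the count drops by exactly one when `f k` satisfies `Q`.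
  count-unhit : ∀ m k {D f} Q → (∀ {j} → j < k → T (D j) → f j < m) → InjectiveOn k D f →
    count m Q ≡ count m (λ v → Q v ∧ unhit k D f v) + count k (λ j → D j ∧ Q (f j))
  count-unhit m zero Q b inj =
    sym (trans (+-identityʳ _) (count-cong m λ {v} _ → ∧-identityʳ (Q v)))
  count-unhit m (suc k) {D} {f} Q b inj = begin
    count m Q                    ≡⟨ count-unhit m k Q (b ∘ m<n⇒m<1+n) inj′ ⟩
    count m Q′ + c               ≡⟨ cong (_+ c) last ⟩
    count m Q″ + ⟦ D k ∧ Q (f k) ⟧ + c  ≡⟨ +-assoc (count m Q″) _ _ ⟩
    count m Q″ + (⟦ D k ∧ Q (f k) ⟧ + c) ≡⟨ cong (count m Q″ +_) (+-comm _ c) ⟩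
    count m Q″ + (c + ⟦ D k ∧ Q (f k) ⟧) ∎
    where
    open ≡-Reasoning
    c = count k (λ j → D j ∧ Q (f j))
    Q′ Q″ : ℕ → Bool
    Q′ v = Q v ∧ unhit k D f v
    Q″ v = Q v ∧ unhit (suc k) D f v
    inj′ : InjectiveOn k D f
    inj′ i<k j<k = inj (m<n⇒m<1+n i<k) (m<n⇒m<1+n j<k)
    last : count m Q′ ≡ count m Q″ + ⟦ D k ∧ Q (f k) ⟧
    last with D k in eq
    ... | false = sym (trans (+-identityʳ _)
                    (count-cong m λ {v} _ → cong (Q v ∧_) (∧-identityʳ _)))
    ... | true = trans (count-remove m Q′ (b (n<1+n k) Dk))
                   (cong₂ _+_ (count-cong m λ {v} _ → ∧-assoc (Q v) _ _) (cong ⟦_⟧ Q′fk))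
      where
      Dk : T (D k)
      Dk = ≡true⇒T eq
      Q′fk : Q′ (f k) ≡ Q (f k)
      Q′fk = trans (cong (Q (f k) ∧_) (T⇒≡true (unhit⁺ k {D} {f} λ j<k d e →
               <⇒≢ j<k (inj (m<n⇒m<1+n j<k) (n<1+n k) d Dk e)))) (∧-identityʳ _)

  record Permutes (m : ℕ) (f : ℕ → ℕ) : Set where
    field
      bounded   : ∀ {i} → i < m → f i < m
      injective : ∀ {i j} → i < m → j < m → f i ≡ f j → i ≡ j

    private
      inj : InjectiveOn m (const true) f
      inj i<m j<m _ _ = injective i<m j<m

      -- Pigeonhole: all `m` positions remove distinct values from a stock of `m`, so `count-unhit`
      -- leaves nothing over. Surjectivity is read off from this.
      missed : count m (λ v → true ∧ unhit m (const true) f v) ≡ 0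
      missed = +-cancelʳ-≡ m _ _
        (trans (cong (count m (λ v → true ∧ unhit m (const true) f v) +_) (sym (count-true m)))
          (trans (sym (count-unhit m m {const true} {f} (const true) (λ j<m _ → bounded j<m) inj))
            (count-true m)))

    surjective : ∀ {v} → v < m → ∃ λ j → j < m × f j ≡ v
    surjective {v} v<m with T? (anyB m (λ j → f j ≡ᵇ v))
    ... | yes t = let j , j<m , e = anyB⁻ m t in j , j<m , ≡ᵇ⇒≡ (f j) v e
    ... | no ¬t = ⊥-elim (count≡0⁻ m missed v<m
                    (unhit⁺ m {f = f} λ {j} j<m _ e → ¬t (anyB⁺ m j<m (≡⇒≡ᵇ (f j) v e))))

    count-∘ : ∀ Q → count m (Q ∘ f) ≡ count m Q
    count-∘ Q = sym (trans
      (count-unhit m m {const true} {f} Q (λ j<m _ → bounded j<m) inj)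
      (cong (_+ count m (Q ∘ f)) (count≡0⁺ m λ {v} v<m t →
        let j , j<m , e = surjective v<m
        in unhit⁻ m {f = f} (∧ʳ {Q v} t) j<m tt e)))

  -- Doubling by recursion, so that `isEven` and `⌊_/2⌋` compute on successors; the passage to
  -- `n + n` happens only once, at the very end.
  dbl : ℕ → ℕ
  dbl zero    = 0
  dbl (suc n) = suc (suc (dbl n))

  dbl≡ : ∀ n → dbl n ≡ n + n
  dbl≡ zero    = refl
  dbl≡ (suc n) = cong suc (trans (cong suc (dbl≡ n)) (sym (+-suc n n)))

  dbl-mono-≤ : ∀ {i j} → i ≤ j → dbl i ≤ dbl j
  dbl-mono-≤ z≤n       = z≤n
  dbl-mono-≤ (s≤s i≤j) = s≤s (s≤s (dbl-mono-≤ i≤j))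

  dbl-≤-suc : ∀ {i j} → dbl i ≤ suc (dbl j) → i ≤ j
  dbl-≤-suc le = ≮⇒≥ λ j<i → <⇒≱ (s≤s (n<1+n _)) (≤-trans (dbl-mono-≤ j<i) le)

  dbl-cancel-≤ : ∀ {i j} → dbl i ≤ dbl j → i ≤ j
  dbl-cancel-≤ le = dbl-≤-suc (m≤n⇒m≤1+n le)

  dbl-cancel-< : ∀ {i j} → dbl i < dbl j → i < j
  dbl-cancel-< {i} {j} lt = ≰⇒> λ j≤i → ≤⇒≯ (dbl-mono-≤ j≤i) lt

  dbl-∸ : ∀ i j → dbl i ∸ dbl j ≡ dbl (i ∸ j)
  dbl-∸ i       zero    = refl
  dbl-∸ zero    (suc j) = refl
  dbl-∸ (suc i) (suc j) = dbl-∸ i j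

  isEven-dbl : ∀ n → isEven (dbl n) ≡ true
  isEven-dbl zero    = refl
  isEven-dbl (suc n) = isEven-dbl n

  isEven-1+dbl : ∀ n → isEven (suc (dbl n)) ≡ false
  isEven-1+dbl zero    = refl
  isEven-1+dbl (suc n) = isEven-1+dbl n

  ⌊dbl/2⌋ : ∀ n → ⌊ dbl n /2⌋ ≡ n
  ⌊dbl/2⌋ zero    = refl
  ⌊dbl/2⌋ (suc n) = cong suc (⌊dbl/2⌋ n)

  ⌊1+dbl/2⌋ : ∀ n → ⌊ suc (dbl n) /2⌋ ≡ n
  ⌊1+dbl/2⌋ zero    = refl
  ⌊1+dbl/2⌋ (suc n) = cong suc (⌊1+dbl/2⌋ n)

  data Parity : ℕ → Set where
    even : ∀ k → Parity (dbl k)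
    odd  : ∀ k → Parity (suc (dbl k))

  parity : ∀ n → Parity n
  parity zero = even 0
  parity (suc n) with parity n
  ... | even k = odd k
  ... | odd k  = even (suc k)

  count-even : ∀ n → count (dbl n) isEven ≡ n
  count-even zero = refl
  count-even (suc n) rewrite isEven-dbl n | isEven-1+dbl n | count-even n =
    trans (+-identityʳ _) (+-comm n 1)

  count-odd : ∀ n → count (dbl n) (not ∘ isEven) ≡ n
  count-odd zero = refl
  count-odd (suc n) rewrite isEven-dbl n | isEven-1+dbl n | count-odd n =
    trans (cong (_+ 1) (+-identityʳ n)) (+-comm n 1)

open Counting

-- Updating functions at a point, ranges of indices

infixl 8 _[_≔_]
_[_≔_] : ∀ {a} {A : Set a} → (ℕ → A) → ℕ → A → ℕ → A
(f [ i ≔ x ]) j = if j ≡ᵇ i then x else f j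

≔-here : ∀ {a} {A : Set a} (f : ℕ → A) i {x} → (f [ i ≔ x ]) i ≡ x
≔-here f i rewrite T⇒≡true (≡⇒≡ᵇ i i ≡.refl) = ≡.refl

≔-there : ∀ {a} {A : Set a} (f : ℕ → A) {i j x} → j ≢ i → (f [ i ≔ x ]) j ≡ f j
≔-there f {i} {j} j≢i rewrite ¬T⇒≡false {j ≡ᵇ i} (j≢i ∘ ≡ᵇ⇒≡ j i) = ≡.refl

≔-cong : ∀ {a} {A : Set a} {f g : ℕ → A} i x → f ≗ g → f [ i ≔ x ] ≗ g [ i ≔ x ]
≔-cong i x e j with j ≡ᵇ i
... | true  = ≡.refl
... | false = e j

≔-comm : ∀ {a} {A : Set a} (f : ℕ → A) {i j} x y → i ≢ j →
         f [ i ≔ x ] [ j ≔ y ] ≗ f [ j ≔ y ] [ i ≔ x ]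
≔-comm f {i} {j} x y i≢j k with k ≡ᵇ j in kj | k ≡ᵇ i in ki
... | true  | true  = ⊥-elim (i≢j (≡.trans (≡.sym (≡ᵇ⇒≡ k i (≡true⇒T ki))) (≡ᵇ⇒≡ k j (≡true⇒T kj))))
... | true  | false = ≡.refl
... | false | true  = ≡.refl
... | false | false = ≡.refl

cons : ∀ {a} {A : Set a} → A → (ℕ → A) → ℕ → A
cons x f zero    = x
cons x f (suc i) = f i

range-suc : ∀ k → 0 ∷ map suc (range k) ↭ range (suc k)
range-suc zero    = ↭-refl
range-suc (suc k) = ↭-trans (swap 0 (suc k) ↭-refl) (prep (suc k) (range-suc k))

∈-range⁻ : ∀ {i} k → i ∈ range k → i < k
∈-range⁻ (suc k) (here ≡.refl) = n<1+n k
∈-range⁻ (suc k) (there i∈)    = m<n⇒m<1+n (∈-range⁻ k i∈)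

∈-range⁺ : ∀ {i} k → i < k → i ∈ range k
∈-range⁺ (suc k) i<1+k with m<1+n⇒m<n∨m≡n i<1+k
... | inj₁ i<k    = there (∈-range⁺ k i<k)
... | inj₂ ≡.refl = here ≡.refl

-- Finite sums and products: over values, functions, subsets and fillings

module Sums {c ℓ} (R : CommutativeRing c ℓ) where
  open CommutativeRing R
  open import Relation.Binary.Reasoning.Setoid setoid
  open import Algebra.Properties.CommutativeSemigroup +-commutativeSemigroup
    using () renaming (interchange to +-interchange)
  open import Algebra.Properties.CommutativeSemigroup *-commutativeSemigroup
    using () renaming (x∙yz≈y∙xz to x*yz≈y*xz)

  sumR-cong : ∀ k {g h} → (∀ {i} → i < k → g i ≈ h i) → sumR R k g ≈ sumR R k h
  sumR-cong zero    e = refl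
  sumR-cong (suc k) e = +-cong (sumR-cong k (e ∘ m<n⇒m<1+n)) (e (n<1+n k))

  sumR-+ : ∀ k {g h} → sumR R k (λ i → g i + h i) ≈ sumR R k g + sumR R k h
  sumR-+ zero    = sym (+-identityˡ 0#)
  sumR-+ (suc k) = trans (+-congʳ (sumR-+ k)) (+-interchange _ _ _ _)

  sumR-0 : ∀ k → sumR R k (const 0#) ≈ 0#
  sumR-0 zero    = refl
  sumR-0 (suc k) = trans (+-identityʳ _) (sumR-0 k)

  sumR-*ʳ : ∀ k {g x} → sumR R k (λ i → g i * x) ≈ sumR R k g * x
  sumR-*ʳ zero    = sym (zeroˡ _)
  sumR-*ʳ (suc k) = trans (+-congʳ (sumR-*ʳ k)) (sym (distribʳ _ _ _))

  sumR-*ˡ : ∀ k {g x} → sumR R k (λ i → x * g i) ≈ x * sumR R k g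
  sumR-*ˡ zero    = sym (zeroʳ _)
  sumR-*ˡ (suc k) = trans (+-congʳ (sumR-*ˡ k)) (sym (distribˡ _ _ _))

  sumR-swap : ∀ k l {g : ℕ → ℕ → Carrier} →
    sumR R k (λ i → sumR R l (g i)) ≈ sumR R l (λ j → sumR R k (λ i → g i j))
  sumR-swap zero    l = sym (sumR-0 l)
  sumR-swap (suc k) l = trans (+-congʳ (sumR-swap k l)) (sym (sumR-+ l))

  sumR-head : ∀ k {g} → sumR R (suc k) g ≈ g 0 + sumR R k (g ∘ suc)
  sumR-head zero    = +-comm 0# _
  sumR-head (suc k) = trans (+-congʳ (sumR-head k)) (+-assoc _ _ _)

  sumR-reverse : ∀ k {g} → sumR R k (λ r → g (k ∸ 1 ∸ r)) ≈ sumR R k g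
  sumR-reverse zero        = refl
  sumR-reverse (suc k) {g} = begin
    sumR R (suc k) (λ r → g (k ∸ r))       ≈⟨ sumR-head k ⟩
    g k + sumR R k (λ r → g (k ∸ suc r))   ≈⟨ +-congˡ (sumR-cong k λ {r} _ → reflexive (cong g (≡.sym (∸-+-assoc k 1 r)))) ⟩
    g k + sumR R k (λ r → g (k ∸ 1 ∸ r))   ≈⟨ +-congˡ (sumR-reverse k) ⟩
    g k + sumR R k g                       ≈⟨ +-comm _ _ ⟩
    sumR R k g + g k ∎

  sumR-dbl : ∀ n {g} → (∀ i → g (suc (dbl i)) ≈ 0#) →
             sumR R (suc (dbl n)) g ≈ sumR R (suc n) (g ∘ dbl)
  sumR-dbl zero    e = refl
  sumR-dbl (suc n) e = +-congʳ (trans (+-congˡ (e n)) (trans (+-identityʳ _) (sumR-dbl n e)))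

  -- As `v` runs upwards through `V`, the rank `count v V` takes the values 0, 1, 2, ... once each.
  -- The sum thus forgets which values are available and keeps only their number.
  sumR-rank : ∀ m V w →
    sumR R m (λ v → if V v then w (count v V) else 0#) ≈ sumR R (count m V) w
  sumR-rank zero    V w = refl
  sumR-rank (suc m) V w with V m
  ... | true  rewrite ℕₚ.+-comm (count m V) 1      = +-congʳ (sumR-rank m V w)
  ... | false rewrite ℕₚ.+-identityʳ (count m V) = trans (+-identityʳ _) (sumR-rank m V w)

  prodL : List ℕ → (ℕ → Carrier) → Carrier
  prodL []       g = 1#
  prodL (i ∷ is) g = g i * prodL is g

  prodL-cong : ∀ is {g h} → (∀ {i} → i ∈ is → g i ≈ h i) → prodL is g ≈ prodL is h
  prodL-cong []       e = refl
  prodL-cong (i ∷ is) e = *-cong (e (here ≡.refl)) (prodL-cong is (e ∘ there))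

  prodL-↭ : ∀ {is js} → is ↭ js → ∀ {g} → prodL is g ≈ prodL js g
  prodL-↭ ↭.refl          = refl
  prodL-↭ (prep i p)      = *-congˡ (prodL-↭ p)
  prodL-↭ (swap i j p)    = trans (*-congˡ (*-congˡ (prodL-↭ p))) (x*yz≈y*xz _ _ _)
  prodL-↭ (↭.trans p q) = trans (prodL-↭ p) (prodL-↭ q)

  prodL-0 : ∀ {is i g} → i ∈ is → g i ≈ 0# → prodL is g ≈ 0#
  prodL-0 (here ≡.refl) e = trans (*-congʳ e) (zeroˡ _)
  prodL-0 (there i∈)    e = trans (*-congˡ (prodL-0 i∈ e)) (zeroʳ _)

  sumList-++ : ∀ xs {ys} → sumList R (xs ++ ys) ≈ sumList R xs + sumList R ys
  sumList-++ []       = sym (+-identityˡ _)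
  sumList-++ (x ∷ xs) = trans (+-congˡ (sumList-++ xs)) (sym (+-assoc _ _ _))

  sumList-map-cong : ∀ {A : Set} (xs : List A) {g h} → (∀ x → g x ≈ h x) →
                     sumList R (map g xs) ≈ sumList R (map h xs)
  sumList-map-cong []       e = refl
  sumList-map-cong (x ∷ xs) e = +-cong (e x) (sumList-map-cong xs e)

  sumList-allLists : ∀ k m (h : List ℕ → Carrier) →
    sumList R (map h (allLists (suc k) m)) ≈ sumR R m (λ a → sumList R (map (h ∘ (a ∷_)) (allLists k m)))
  sumList-allLists k m h = go m
    where
    go : ∀ n → sumList R (map h (concatMap (λ a → map (a ∷_) (allLists k m)) (range n)))
             ≈ sumR R n (λ a → sumList R (map (h ∘ (a ∷_)) (allLists k m)))
    go zero = refl
    go (suc n) = begin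
      sumList R (map h (map (n ∷_) (allLists k m) ++ rest))
        ≡⟨ cong (sumList R) (map-++ h (map (n ∷_) (allLists k m)) rest) ⟩
      sumList R (map h (map (n ∷_) (allLists k m)) ++ map h rest)
        ≈⟨ sumList-++ (map h (map (n ∷_) (allLists k m))) ⟩
      sumList R (map h (map (n ∷_) (allLists k m))) + sumList R (map h rest)
        ≈⟨ +-cong (reflexive (cong (sumList R) (≡.sym (map-∘ (allLists k m))))) (go n) ⟩
      sumList R (map (h ∘ (n ∷_)) (allLists k m)) + sumR R n _
        ≈⟨ +-comm _ _ ⟩
      sumR R n _ + sumList R (map (h ∘ (n ∷_)) (allLists k m)) ∎
      where rest = concatMap (λ a → map (a ∷_) (allLists k m)) (range n)

  -- Updates made in different orders yield functions that are equal pointwise only, so every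
  -- summand has to respect pointwise equality before positions may be permuted.
  Extensional : ((ℕ → ℕ) → Carrier) → Set ℓ
  Extensional h = ∀ {f g} → f ≗ g → h f ≈ h g

  -- Sum of h over all ways of reassigning values below m to the positions is, starting from f.
  sumF : ℕ → List ℕ → (ℕ → ℕ) → ((ℕ → ℕ) → Carrier) → Carrier
  sumF m []       f h = h f
  sumF m (i ∷ is) f h = sumR R m (λ v → sumF m is (f [ i ≔ v ]) h)

  sumF-ext : ∀ m is {h} → Extensional h → Extensional (λ f → sumF m is f h)
  sumF-ext m []       ext e = ext e
  sumF-ext m (i ∷ is) ext e = sumR-cong m λ {v} _ → sumF-ext m is ext (≔-cong i v e)

  sumF-cong : ∀ m is {f h k} → (∀ g → h g ≈ k g) → sumF m is f h ≈ sumF m is f k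
  sumF-cong m []       e = e _
  sumF-cong m (i ∷ is) e = sumR-cong m λ _ → sumF-cong m is e

  sumF-+ : ∀ m is {f h k} → sumF m is f (λ g → h g + k g) ≈ sumF m is f h + sumF m is f k
  sumF-+ m []       = refl
  sumF-+ m (i ∷ is) = trans (sumR-cong m λ _ → sumF-+ m is) (sumR-+ m)

  sumF-↭ : ∀ m {is js} → is ↭ js → ∀ {h} → Extensional h → ∀ f → sumF m is f h ≈ sumF m js f h
  sumF-↭ m ↭.refl       ext f = refl
  sumF-↭ m (prep i p)   ext f = sumR-cong m λ _ → sumF-↭ m p ext _
  sumF-↭ m {_ ∷ _ ∷ is} {_ ∷ _ ∷ js} (swap i j p) {h} ext f = begin
    sumR R m (λ v → sumR R m (λ w → sumF m is (f [ i ≔ v ] [ j ≔ w ]) h))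
      ≈⟨ sumR-cong m (λ _ → sumR-cong m λ _ → sumF-↭ m p ext _) ⟩
    sumR R m (λ v → sumR R m (λ w → sumF m js (f [ i ≔ v ] [ j ≔ w ]) h))
      ≈⟨ sumR-swap m m ⟩
    sumR R m (λ w → sumR R m (λ v → sumF m js (f [ i ≔ v ] [ j ≔ w ]) h))
      ≈⟨ exchange ⟩
    sumR R m (λ w → sumR R m (λ v → sumF m js (f [ j ≔ w ] [ i ≔ v ]) h)) ∎
    where
    exchange : sumR R m (λ w → sumR R m (λ v → sumF m js (f [ i ≔ v ] [ j ≔ w ]) h))
             ≈ sumR R m (λ w → sumR R m (λ v → sumF m js (f [ j ≔ w ] [ i ≔ v ]) h))
    exchange with i ≟ j
    -- Updates at the same position do not commute, but then the two double sums differ only in the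
    -- order of summation.
    ... | yes ≡.refl = sumR-swap m m
    ... | no i≢j = sumR-cong m λ {w} _ → sumR-cong m λ {v} _ →
                     sumF-ext m js ext (≔-comm f v w i≢j)
  sumF-↭ m (↭.trans p q) ext f = trans (sumF-↭ m p ext f) (sumF-↭ m q ext f)

  sumF-cons : ∀ m is {a f h} → Extensional h →
    sumF m is f (h ∘ cons a) ≈ sumF m (map suc is) (cons a f) h
  sumF-cons m []       ext = refl
  sumF-cons m (i ∷ is) {a} {f} {h} ext = sumR-cong m λ {v} _ →
    trans (sumF-cons m is ext) (sumF-ext m (map suc is) ext (cons-≔ v))
    where
    cons-≔ : ∀ v → cons a (f [ i ≔ v ]) ≗ cons a f [ suc i ≔ v ]
    cons-≔ v zero    = ≡.refl
    cons-≔ v (suc j) = ≡.refl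

  sumList-allLists-at : ∀ k m {h} → Extensional h →
    sumList R (map (h ∘ at) (allLists k m)) ≈ sumF m (range k) (const 0) h
  sumList-allLists-at zero    m ext = +-identityʳ _
  sumList-allLists-at (suc k) m {h} ext = begin
    sumList R (map (h ∘ at) (allLists (suc k) m))
      ≈⟨ sumList-allLists k m (h ∘ at) ⟩
    sumR R m (λ a → sumList R (map (λ l → h (at (a ∷ l))) (allLists k m)))
      ≈⟨ sumR-cong m (λ _ → sumList-map-cong (allLists k m) λ l → ext (at-∷ l)) ⟩
    sumR R m (λ a → sumList R (map (λ l → h (cons a (at l))) (allLists k m)))
      ≈⟨ sumR-cong m (λ _ → sumList-allLists-at k m (ext ∘ cons-cong)) ⟩
    sumR R m (λ a → sumF m (range k) (const 0) (h ∘ cons a))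
      ≈⟨ sumR-cong m (λ _ → trans (sumF-cons m (range k) ext) (sumF-ext m (map suc (range k)) ext cons≗≔)) ⟩
    sumF m (0 ∷ map suc (range k)) (const 0) h
      ≈⟨ sumF-↭ m (range-suc k) ext (const 0) ⟩
    sumF m (range (suc k)) (const 0) h ∎
    where
    at-∷ : ∀ {a} l → at (a ∷ l) ≗ cons a (at l)
    at-∷ l zero    = ≡.refl
    at-∷ l (suc i) = ≡.refl
    cons-cong : ∀ {a f g} → f ≗ g → cons a f ≗ cons a g
    cons-cong e zero    = ≡.refl
    cons-cong e (suc i) = e i
    cons≗≔ : ∀ {a} → cons a (const 0) ≗ const 0 [ 0 ≔ a ]
    cons≗≔ zero    = ≡.refl
    cons≗≔ (suc i) = ≡.refl

  -- This moves the factor of a position already filled in front of the sums over the open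
  -- positions.
  sumF-*ˡ : ∀ m is {f} {u h : (ℕ → ℕ) → Carrier} {x} →
    (∀ g → (∀ {j} → j ∉ is → g j ≡ f j) → u g ≈ x) →
    sumF m is f (λ g → u g * h g) ≈ x * sumF m is f h
  sumF-*ˡ m []       e = *-congʳ (e _ λ _ → ≡.refl)
  sumF-*ˡ m (i ∷ is) {f} e = trans (sumR-cong m λ {v} _ → sumF-*ˡ m is λ g agree →
      e g λ {j} j∉ → ≡.trans (agree (j∉ ∘ there)) (≔-there f (j∉ ∘ here)))
    (sumR-*ˡ m)

  sumB : ℕ → ((ℕ → Bool) → Carrier) → Carrier
  sumB zero    g = g (const false)
  sumB (suc k) g = sumB k (λ A → g (A [ k ≔ true ]) + g (A [ k ≔ false ]))

  sumB-cong : ∀ k {g h} → (∀ A → g A ≈ h A) → sumB k g ≈ sumB k h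
  sumB-cong zero    e = e _
  sumB-cong (suc k) e = sumB-cong k λ A → +-cong (e _) (e _)

  sumB-0 : ∀ k {g} → (∀ A → g A ≈ 0#) → sumB k g ≈ 0#
  sumB-0 zero    e = e _
  sumB-0 (suc k) e = sumB-0 k λ A → trans (+-cong (e _) (e _)) (+-identityˡ 0#)

  sumF-sumB : ∀ m is k {f} {g : (ℕ → Bool) → (ℕ → ℕ) → Carrier} →
    sumF m is f (λ f′ → sumB k (λ A → g A f′)) ≈ sumB k (λ A → sumF m is f (g A))
  sumF-sumB m is zero    = refl
  sumF-sumB m is (suc k) = trans (sumF-sumB m is k) (sumB-cong k λ A → sumF-+ m is)

  AgreeBelow : ℕ → (ℕ → Bool) → (ℕ → Bool) → Set
  AgreeBelow k A B = ∀ {i} → i < k → A i ≡ B i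

  agree-≔ : ∀ {k A B b} → AgreeBelow k A B → B k ≡ b → AgreeBelow (suc k) (A [ k ≔ b ]) B
  agree-≔ {k} {A} agree Bk i<1+k with m<1+n⇒m<n∨m≡n i<1+k
  ... | inj₁ i<k    = ≡.trans (≔-there A (<⇒≢ i<k)) (agree i<k)
  ... | inj₂ ≡.refl = ≡.trans (≔-here A k) (≡.sym Bk)

  -- At each level exactly one of the two extensions can still agree with `A₀`; the other one
  -- vanishes by `off`. Agreement is required only below `k`, the range that `sumB` explores.
  sumB-singleton : ∀ k {g} A₀ →
    (∀ {A} → AgreeBelow k A A₀ → g A ≈ g A₀) →
    (∀ A → (g A ≈ 0#) ⊎ AgreeBelow k A A₀) →
    sumB k g ≈ g A₀
  sumB-singleton zero    A₀ ext off = ext λ ()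
  sumB-singleton (suc k) {g} A₀ ext off =
    trans (sumB-singleton k A₀ ext′ off′) (value (λ _ → ≡.refl))
    where
    g′ : (ℕ → Bool) → Carrier
    g′ A = g (A [ k ≔ true ]) + g (A [ k ≔ false ])
    value : ∀ {A} → AgreeBelow k A A₀ → g′ A ≈ g A₀
    value {A} agree with A₀ k in eq
    ... | true = trans (+-cong (ext (agree-≔ agree eq)) vanish) (+-identityʳ _)
      where
      vanish : g (A [ k ≔ false ]) ≈ 0#
      vanish with off (A [ k ≔ false ])
      ... | inj₁ z = z
      ... | inj₂ e with ≡.trans (≡.sym (≔-here A k)) (≡.trans (e (n<1+n k)) eq)
      ...   | ()
    ... | false = trans (+-cong vanish (ext (agree-≔ agree eq))) (+-identityˡ _)
      where
      vanish : g (A [ k ≔ true ]) ≈ 0#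
      vanish with off (A [ k ≔ true ])
      ... | inj₁ z = z
      ... | inj₂ e with ≡.trans (≡.sym (≔-here A k)) (≡.trans (e (n<1+n k)) eq)
      ...   | ()
    ext′ : ∀ {A} → AgreeBelow k A A₀ → g′ A ≈ g′ A₀
    ext′ agree = trans (value agree) (sym (value λ _ → ≡.refl))
    off′ : ∀ A → (g′ A ≈ 0#) ⊎ AgreeBelow k A A₀
    off′ A with off (A [ k ≔ true ]) | off (A [ k ≔ false ])
    ... | inj₁ z | inj₁ z′ = inj₁ (trans (+-cong z z′) (+-identityˡ _))
    ... | inj₂ e | _ = inj₂ λ i<k → ≡.trans (≡.sym (≔-there A (<⇒≢ i<k))) (e (m<n⇒m<1+n i<k))
    ... | inj₁ _ | inj₂ e = inj₂ λ i<k → ≡.trans (≡.sym (≔-there A (<⇒≢ i<k))) (e (m<n⇒m<1+n i<k))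

  -- Positions are filled one after another; D i is the set of positions whose values
  -- restrict the choice at i, and elig i the set of values allowed at i a priori.
  module Filling (m : ℕ) (elig D : ℕ → ℕ → Bool) (wt : ℕ → ℕ → ℕ → Carrier)
    (elig-bound : ∀ i v → T (elig i v) → v < m)
    (elig-mono  : ∀ i j v → T (D i j) → T (elig j v) → T (elig i v))
    (D-irrefl   : ∀ i → ¬ T (D i i))
    (D-total    : ∀ i j k → T (D i j) → T (D i k) → j ≢ k → T (D j k) ⊎ T (D k j))
    where

    avail : ℕ → (ℕ → ℕ) → ℕ → Bool
    avail i f v = elig i v ∧ unhit m (D i) f v

    choice : ℕ → (ℕ → Bool) → ℕ → Carrier
    choice i V v = if V v then wt i (count m V) (count v V) else 0#

    factor : ℕ → (ℕ → ℕ) → Carrier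
    factor i f = choice i (avail i f) (f i)

    total : ℕ → Carrier
    total i = sumR R N (wt i N)
      where N = count m (elig i) ∸ count m (D i)

    choice-cong : ∀ i {V W : ℕ → Bool} {v w} → V ≗ W → v ≡ w → choice i V v ≡ choice i W w
    choice-cong i {V} {W} {v} V≗W ≡.refl
      rewrite V≗W v | count-cong m {V} {W} (λ {u} _ → V≗W u) | count-cong v {V} {W} (λ {u} _ → V≗W u) = ≡.refl

    avail-local : ∀ i {f g} → (∀ {j} → T (D i j) → f j ≡ g j) → avail i f ≗ avail i g
    avail-local i {f} {g} e v = cong (elig i v ∧_) (allB-cong m λ {j} _ → pointwise j)
      where
      pointwise : ∀ j → not (D i j ∧ (f j ≡ᵇ v)) ≡ not (D i j ∧ (g j ≡ᵇ v))
      pointwise j with D i j in eq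
      ... | true  = cong (λ x → not (x ≡ᵇ v)) (e (≡true⇒T eq))
      ... | false = ≡.refl

    factor-ext : ∀ i → Extensional (factor i)
    factor-ext i e = reflexive (choice-cong i (avail-local i λ {j} _ → e j) (e i))

    Filled : (ℕ → ℕ) → List ℕ → Set
    Filled f is = ∀ {j} → j < m → j ∉ is → T (avail j f (f j))

    -- Filled positions do not look at open ones, so filling the rest cannot spoil the availability
    -- already established.
    Closed : List ℕ → Set
    Closed is = ∀ {i j} → i ∈ is → j < m → j ∉ is → ¬ T (D j i)

    Order : List ℕ → Set
    Order = AllPairs (λ i j → i ≢ j × ¬ T (D i j))

    -- By `elig-mono` the values at the positions of `D i` are all eligible at `i`. They are
    -- distinct, since of two such positions one precedes the other and its value was avoided by the
    -- later one. So the number of eligible values lost does not depend on the choices made.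
    count-avail : ∀ i {f} → (∀ {j} → j < m → T (D i j) → T (avail j f (f j))) →
      count m (avail i f) ≡ count m (elig i) ∸ count m (D i)
    count-avail i {f} ok = ≡.sym (≡R.begin
      count m (elig i) ∸ count m (D i)
        ≡R.≡⟨ cong (_∸ count m (D i)) (count-unhit m m {D i} {f} (elig i) (λ j<m d → elig-bound i _ (elig-f j<m d)) inj) ⟩
      count m (avail i f) ℕ.+ count m (λ j → D i j ∧ elig i (f j)) ∸ count m (D i)
        ≡R.≡⟨ cong (λ x → count m (avail i f) ℕ.+ x ∸ count m (D i))
             (count-cong m λ {j} j<m → T-iff ∧ˡ λ d → d & elig-f j<m d) ⟩
      count m (avail i f) ℕ.+ count m (D i) ∸ count m (D i)
        ≡R.≡⟨ m+n∸n≡m _ (count m (D i)) ⟩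
      count m (avail i f) ≡R.∎)
      where
      module ≡R = ≡.≡-Reasoning
      elig-f : ∀ {j} → j < m → T (D i j) → T (elig i (f j))
      elig-f j<m d = elig-mono i _ _ d (∧ˡ (ok j<m d))
      inj : InjectiveOn m (D i) f
      inj {j} {k} j<m k<m dj dk e with j ≟ k
      ... | yes j≡k = j≡k
      ... | no j≢k with D-total i j k dj dk j≢k
      ...   | inj₁ d = ⊥-elim (unhit⁻ m {D j} {f} (∧ʳ {elig j (f j)} (ok j<m dj)) k<m d (≡.sym e))
      ...   | inj₂ d = ⊥-elim (unhit⁻ m {D k} {f} (∧ʳ {elig k (f k)} (ok k<m dk)) j<m d e)

    -- The factor of the first position depends only on positions already fixed and comes out of the
    -- inner sums. What remains is, by induction, the same product for every available choice, so
    -- the sum over that choice can be taken by rank.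
    fill : ∀ is {f} → Order is → Closed is → Filled f is →
      sumF m is f (λ g → prodL is (λ i → factor i g)) ≈ prodL is total
    fill []       ord closed filled = refl
    fill (i ∷ is) {f} (i-first ∷ ord) closed filled = begin
      sumR R m (λ v → sumF m is (f [ i ≔ v ]) (λ g → factor i g * rest g))
        ≈⟨ sumR-cong m (λ {v} _ → sumF-*ˡ m is (local v)) ⟩
      sumR R m (λ v → choice i V v * sumF m is (f [ i ≔ v ]) rest)
        ≈⟨ sumR-cong m (λ {v} _ → onChoice v) ⟩
      sumR R m (λ v → choice i V v * prodL is total)
        ≈⟨ sumR-*ʳ m ⟩
      sumR R m (choice i V) * prodL is total
        ≈⟨ *-congʳ (sumR-rank m V (wt i (count m V))) ⟩
      sumR R (count m V) (wt i (count m V)) * prodL is total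
        ≡⟨ cong (λ n → sumR R n (wt i n) * prodL is total) (count-avail i λ j<m d → filled j<m (D∉ d)) ⟩
      total i * prodL is total ∎
      where
      V = avail i f
      rest : (ℕ → ℕ) → Carrier
      rest g = prodL is (λ k → factor k g)
      D∉ : ∀ {j} → T (D i j) → j ∉ i ∷ is
      D∉ d (here ≡.refl) = D-irrefl i d
      D∉ d (there j∈)    = proj₂ (All.lookup i-first j∈) d
      i∉is : i ∉ is
      i∉is i∈ = proj₁ (All.lookup i-first i∈) ≡.refl
      ≔-D : ∀ {v j} → T (D i j) → (f [ i ≔ v ]) j ≡ f j
      ≔-D d = ≔-there f λ { ≡.refl → D-irrefl i d }
      local : ∀ v g → (∀ {j} → j ∉ is → g j ≡ (f [ i ≔ v ]) j) → factor i g ≈ choice i V v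
      local v g agree = reflexive (choice-cong i
        (avail-local i λ d → ≡.trans (agree (D∉ d ∘ there)) (≔-D d))
        (≡.trans (agree i∉is) (≔-here f i)))
      onChoice : ∀ v → choice i V v * sumF m is (f [ i ≔ v ]) rest ≈ choice i V v * prodL is total
      onChoice v with V v in eq
      ... | false = trans (zeroˡ _) (sym (zeroˡ _))
      ... | true  = *-congˡ (fill is ord closed′ filled′)
        where
        closed′ : Closed is
        closed′ {k} {j} k∈ j<m j∉ with j ≟ i
        ... | yes ≡.refl = proj₂ (All.lookup i-first k∈)
        ... | no j≢i = closed (there k∈) j<m λ { (here e) → j≢i e ; (there j∈) → j∉ j∈ }
        filled′ : Filled (f [ i ≔ v ]) is
        filled′ {j} j<m j∉ with j ≟ i
        ... | yes ≡.refl = subst T (≡.sym (≡.trans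
                (cong (avail i (f [ i ≔ v ])) (≔-here f i))
                (≡.trans (avail-local i ≔-D v) eq))) tt
        ... | no j≢i = subst T (≡.sym (≡.trans
                (cong (avail j (f [ i ≔ v ])) (≔-there f j≢i))
                (avail-local j (λ {k} d → ≔-there f λ { ≡.refl → closed (here ≡.refl) j<m j∉′ d }) (f j))))
                (filled j<m j∉′)
          where
          j∉′ : j ∉ i ∷ is
          j∉′ (here e)   = j≢i e
          j∉′ (there j∈) = j∉ j∈

-- Weighted walks and the T-fraction

module Walks {c ℓ} (R : CommutativeRing c ℓ) where
  open CommutativeRing R
  open Sums R
  open import Relation.Binary.Reasoning.Setoid setoid
  open import Algebra.Properties.CommutativeSemigroup *-commutativeSemigroup
    using () renaming (x∙yz≈y∙xz to x*yz≈y*xz)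
  open import Algebra.Properties.CommutativeSemigroup +-commutativeSemigroup
    using () renaming (x∙yz≈y∙xz to x+yz≈y+xz)

  -- The recurrence is f = 1 + d t f + a t f′ f read coefficientwise, with f′ one level further up.
  -- Each coefficient uses lower ones only, so induction on the depth of the table suffices.
  tab-unique : ∀ (a d : ℕ → Carrier) (F : ℕ → ℕ → Carrier) →
    (∀ k → F (suc k) 0 ≈ 1#) →
    (∀ k i → F (suc k) (suc i) ≈
       d (suc k) * F (suc k) i + a (suc k) * sumR R (suc i) (λ j → F (suc (suc k)) j * F (suc k) (i ∸ j))) →
    ∀ n k {i} → i ≤ n → tab R a d n (suc k) i ≈ F (suc k) i
  tab-unique a d F F-zero F-suc zero    k z≤n = sym (F-zero k)
  tab-unique a d F F-zero F-suc (suc n) k {i} i≤1+n with m≤n⇒m<n∨m≡n i≤1+n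
  ... | inj₁ (s≤s i≤n) rewrite T⇒≡true (≤⇒≤ᵇ i≤n) = tab-unique a d F F-zero F-suc n k i≤n
  ... | inj₂ ≡.refl rewrite ¬T⇒≡false {suc n ≤ᵇ n} (λ t → <⇒≱ (n<1+n n) (≤ᵇ⇒≤ (suc n) n t)) =
    trans (+-cong (*-congˡ (IH k ≤-refl))
            (*-congˡ (sumR-cong (suc n) λ { {j} (s≤s j≤n) → *-cong (IH (suc k) j≤n) (IH k (m∸n≤m n j)) })))
      (sym (F-suc k n))
    where IH = tab-unique a d F F-zero F-suc n

  module _ (up : ℕ → Carrier) where

    -- Weight of the walks with N steps from g to k; up and dn are indexed by the starting height of a step.
    walk : (ℕ → Carrier) → ℕ → ℕ → ℕ → Carrier
    walk dn k zero    g = if g ≡ᵇ k then 1# else 0#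
    walk dn k (suc N) g = up g * walk dn k N (suc g) + dn g * walk dn k N (pred g)

    module _ (dn : ℕ → Carrier) where

      -- Confinement is put into the weights: a walk from height at least `k` that would go below
      -- `k` gets weight 0. Confined walks therefore obey the same recursion as free ones.
      floorDn : ℕ → ℕ → Carrier
      floorDn k g = if g ≤ᵇ k then 0# else dn g

      floorDn-≤ : ∀ {k g} → g ≤ k → floorDn k g ≡ 0#
      floorDn-≤ g≤k rewrite T⇒≡true (≤⇒≤ᵇ g≤k) = ≡.refl

      floorDn-> : ∀ {k g} → k < g → floorDn k g ≡ dn g
      floorDn-> {k} {g} k<g rewrite ¬T⇒≡false {g ≤ᵇ k} (λ t → <⇒≱ k<g (≤ᵇ⇒≤ g k t)) = ≡.refl

      walk≥ : ℕ → ℕ → ℕ → Carrier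
      walk≥ k = walk (floorDn k) k

      walk-here : ∀ dn′ k → walk dn′ k 0 k ≡ 1#
      walk-here dn′ k rewrite T⇒≡true (≡⇒≡ᵇ k k ≡.refl) = ≡.refl

      walk-elsewhere : ∀ dn′ {k g} → g ≢ k → walk dn′ k 0 g ≡ 0#
      walk-elsewhere dn′ {k} {g} g≢k rewrite ¬T⇒≡false {g ≡ᵇ k} (g≢k ∘ ≡ᵇ⇒≡ g k) = ≡.refl

      isEven-+ : ∀ k → isEven (k ℕ.+ k) ≡ true
      isEven-+ k = ≡.trans (cong isEven (≡.sym (dbl≡ k))) (isEven-dbl k)

      walk≥-parity : ∀ k N g → isEven (N ℕ.+ (g ℕ.+ k)) ≡ false → walk≥ k N g ≈ 0#
      walk≥-parity k zero g odd′ = reflexive (walk-elsewhere (floorDn k) {k} {g} λ { ≡.refl → absurd (≡.trans (≡.sym (isEven-+ k)) odd′) })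
        where
        absurd : true ≢ false
        absurd ()
      walk≥-parity k (suc N) g odd′ = trans (+-cong
          (trans (*-congˡ (walk≥-parity k N (suc g) (≡.trans (cong isEven (ℕₚ.+-suc N (g ℕ.+ k))) odd′))) (zeroʳ _))
          (down g odd′))
        (+-identityˡ 0#)
        where
        down : ∀ g → isEven (suc N ℕ.+ (g ℕ.+ k)) ≡ false → floorDn k g * walk≥ k N (pred g) ≈ 0#
        -- At height 0 `pred` would keep the parity of the height, but there `floorDn` is 0.
        down zero    _ = zeroˡ _
        down (suc g) e = trans (*-congˡ (walk≥-parity k N g
          (≡.trans (≡.sym (cong (isEven ∘ suc) (ℕₚ.+-suc N (g ℕ.+ k)))) e))) (zeroʳ _)

      -- Cut at the first step from `suc k` to `k`, made after `j` steps that stay above `k`. `X` is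
      -- abstract because the lemma serves both the free walks and the walks confined above `k`,
      -- whose recursions coincide above `k`.
      first-passage : ∀ k (X : ℕ → ℕ → Carrier) →
        (∀ {g} → k < g → X 0 g ≈ 0#) →
        (∀ N {g} → k < g → X (suc N) g ≈ up g * X N (suc g) + dn g * X N (pred g)) →
        ∀ N {g} → k < g →
        X N g ≈ sumR R N (λ j → walk≥ (suc k) j g * (dn (suc k) * X (N ∸ 1 ∸ j) k))
      first-passage k X X-zero X-suc zero    k<g = X-zero k<g
      first-passage k X X-zero X-suc (suc N) {g} k<g = begin
        X (suc N) g
          ≈⟨ X-suc N k<g ⟩
        up g * X N (suc g) + dn g * X N (pred g)
          ≈⟨ +-cong (*-congˡ (IH (m<n⇒m<1+n k<g))) descend ⟩
        up g * S (suc g) + (walk≥ (suc k) 0 g * Y 0 + floorDn (suc k) g * S (pred g))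
          ≈⟨ x+yz≈y+xz _ _ _ ⟩
        walk≥ (suc k) 0 g * Y 0 + (up g * S (suc g) + floorDn (suc k) g * S (pred g))
          ≈⟨ +-congˡ (+-cong (sumR-*ˡ N) (sumR-*ˡ N)) ⟨
        walk≥ (suc k) 0 g * Y 0 + (sumR R N (λ j → up g * (walk≥ (suc k) j (suc g) * y j))
                               + sumR R N (λ j → floorDn (suc k) g * (walk≥ (suc k) j (pred g) * y j)))
          ≈⟨ +-congˡ (trans (sym (sumR-+ N)) (sumR-cong N λ {j} _ → collect j)) ⟩
        walk≥ (suc k) 0 g * Y 0 + sumR R N (λ j → walk≥ (suc k) (suc j) g * Y (suc j))
          ≈⟨ sumR-head N ⟨
        sumR R (suc N) (λ j → walk≥ (suc k) j g * Y j) ∎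
        where
        y Y : ℕ → Carrier
        y j = dn (suc k) * X (N ∸ 1 ∸ j) k
        Y j = dn (suc k) * X (N ∸ j) k
        S : ℕ → Carrier
        S h = sumR R N (λ j → walk≥ (suc k) j h * y j)
        IH : ∀ {h} → k < h → X N h ≈ S h
        IH = first-passage k X X-zero X-suc N
        collect : ∀ j → up g * (walk≥ (suc k) j (suc g) * y j) + floorDn (suc k) g * (walk≥ (suc k) j (pred g) * y j)
                      ≈ walk≥ (suc k) (suc j) g * Y (suc j)
        collect j = trans (+-cong (sym (*-assoc _ _ _)) (sym (*-assoc _ _ _)))
          (trans (sym (distribʳ _ _ _))
            (*-congˡ (*-congˡ (reflexive (cong (λ n → X n k) (∸-+-assoc N 1 j))))))
        descend : dn g * X N (pred g) ≈ walk≥ (suc k) 0 g * Y 0 + floorDn (suc k) g * S (pred g)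
        descend with m≤n⇒m<n∨m≡n k<g
        ... | inj₁ 1+k<g@(s≤s k<g′)
          rewrite floorDn-> 1+k<g | walk-elsewhere (floorDn (suc k)) {suc k} {g} (<⇒≢ 1+k<g ∘ ≡.sym) =
          trans (*-congˡ (IH k<g′)) (trans (sym (+-identityˡ _)) (+-congʳ (sym (zeroˡ _))))
        -- From height `suc k` the down step is itself the first passage: it gives the term `j = 0`,
        -- and the confined walks exclude it from all others.
        ... | inj₂ ≡.refl
          rewrite floorDn-≤ (≤-refl {suc k}) | walk-here (floorDn (suc k)) (suc k) =
          sym (trans (+-cong (*-identityˡ _) (zeroˡ _)) (+-identityʳ _))

      -- First-return decomposition: an up step, an excursion that stays above `k`, a down step, and
      -- another return to `k`. The term `e` stands for the walks that begin with a down step.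
      return-suc : ∀ k (X : ℕ → ℕ → Carrier) (e : Carrier) n →
        (∀ {g} → k < g → X 0 g ≈ 0#) →
        (∀ N {g} → k < g → X (suc N) g ≈ up g * X N (suc g) + dn g * X N (pred g)) →
        X (dbl (suc n)) k ≈ up k * X (suc (dbl n)) (suc k) + e →
        X (dbl (suc n)) k ≈
          e + (up k * dn (suc k)) * sumR R (suc n) (λ j → walk≥ (suc k) (dbl j) (suc k) * X (dbl (n ∸ j)) k)
      return-suc k X e n X-zero X-suc X-k = begin
        X (dbl (suc n)) k
          ≈⟨ X-k ⟩
        up k * X (suc (dbl n)) (suc k) + e
          ≈⟨ +-comm _ _ ⟩
        e + up k * X (suc (dbl n)) (suc k)
          ≈⟨ +-congˡ (*-congˡ (first-passage k X X-zero X-suc (suc (dbl n)) (n<1+n k))) ⟩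
        e + up k * sumR R (suc (dbl n)) (λ j → W j * (dn (suc k) * X (dbl n ∸ j) k))
          -- An excursion of odd length cannot return to its starting height, so only even `j`
          -- survive.
          ≈⟨ +-congˡ (*-congˡ (sumR-dbl n λ i → trans (*-congʳ (walk≥-parity (suc k) (suc (dbl i)) (suc k)
               (odd-length i))) (zeroˡ _))) ⟩
        e + up k * sumR R (suc n) (λ j → W (dbl j) * (dn (suc k) * X (dbl n ∸ dbl j) k))
          ≈⟨ +-congˡ (*-congˡ (sumR-cong (suc n) λ {j} _ → trans (x*yz≈y*xz _ _ _)
               (*-congˡ (*-congˡ (reflexive (cong (λ m → X m k) (dbl-∸ n j))))))) ⟩
        e + up k * sumR R (suc n) (λ j → dn (suc k) * (W (dbl j) * X (dbl (n ∸ j)) k))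
          ≈⟨ +-congˡ (trans (*-congˡ (sumR-*ˡ (suc n))) (sym (*-assoc _ _ _))) ⟩
        e + (up k * dn (suc k)) * sumR R (suc n) (λ j → W (dbl j) * X (dbl (n ∸ j)) k) ∎
        where
        W : ℕ → Carrier
        W j = walk≥ (suc k) j (suc k)
        odd-length : ∀ i → isEven (suc (dbl i) ℕ.+ (suc k ℕ.+ suc k)) ≡ false
        odd-length zero    = ≡.trans (cong isEven (cong (suc ∘ suc) (ℕₚ.+-suc k k))) (odd′ k)
          where
          odd′ : ∀ k → isEven (suc (k ℕ.+ k)) ≡ false
          odd′ k = ≡.trans (cong (isEven ∘ suc) (≡.sym (dbl≡ k))) (isEven-1+dbl k)
        odd-length (suc i) = odd-length i

      module _ (a d : ℕ → Carrier)
        (dn-0 : dn 0 ≈ 0#)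
        (a≈ : ∀ k → a (suc k) ≈ up (suc k) * dn (suc (suc k)))
        (d₁≈ : d 1 ≈ dn 1 * up 0)
        (d≈0 : ∀ k → d (suc (suc k)) ≈ 0#)
        where

        -- Only at level 1 may a walk go below its start; this exception produces the coefficient
        -- `d 1`, while on the higher levels `d` vanishes.
        returns : ℕ → ℕ → Carrier
        returns (suc zero) i = walk dn 1 (dbl i) 1
        returns k          i = walk≥ k (dbl i) k

        returns-zero : ∀ k → returns (suc k) 0 ≈ 1#
        returns-zero zero    = refl
        returns-zero (suc k) = reflexive (walk-here (floorDn (suc (suc k))) (suc (suc k)))

        returns-suc : ∀ k i → returns (suc k) (suc i) ≈
          d (suc k) * returns (suc k) i
          + a (suc k) * sumR R (suc i) (λ j → returns (suc (suc k)) j * returns (suc k) (i ∸ j))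
        returns-suc zero i = trans
          (return-suc 1 (walk dn 1) (dn 1 * walk dn 1 (suc (dbl i)) 0) i
            (λ {g} k<g → reflexive (walk-elsewhere dn {1} {g} (<⇒≢ k<g ∘ ≡.sym))) (λ _ _ → refl) refl)
          (+-cong dip (*-congʳ (sym (a≈ 0))))
          where
          -- After a step down to height 0 the only continuation is straight back up, because `dn 0`
          -- vanishes.
          dip : dn 1 * (up 0 * walk dn 1 (dbl i) 1 + dn 0 * walk dn 1 (dbl i) 0) ≈ d 1 * walk dn 1 (dbl i) 1
          dip = begin
            dn 1 * (up 0 * walk dn 1 (dbl i) 1 + dn 0 * walk dn 1 (dbl i) 0)
              ≈⟨ *-congˡ (trans (+-congˡ (trans (*-congʳ dn-0) (zeroˡ _))) (+-identityʳ _)) ⟩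
            dn 1 * (up 0 * walk dn 1 (dbl i) 1)
              ≈⟨ *-assoc _ _ _ ⟨
            dn 1 * up 0 * walk dn 1 (dbl i) 1
              ≈⟨ *-congʳ d₁≈ ⟨
            d 1 * walk dn 1 (dbl i) 1 ∎
        returns-suc (suc k) i = trans
          (return-suc (suc (suc k)) (walk≥ (suc (suc k))) 0# i
            (λ {g} k<g → reflexive (walk-elsewhere (floorDn (suc (suc k))) {suc (suc k)} {g} (<⇒≢ k<g ∘ ≡.sym)))
            (λ _ k<g → +-congˡ (*-congʳ (reflexive (floorDn-> k<g))))
            (+-congˡ (trans (*-congʳ (reflexive (floorDn-≤ (≤-refl {suc (suc k)})))) (zeroˡ _))))
          (+-cong (sym (trans (*-congʳ (d≈0 k)) (zeroˡ _))) (*-congʳ (sym (a≈ (suc k)))))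

        walk-Tfrac : ∀ n → walk dn 1 (dbl n) 1 ≈ Tfrac R a d n
        walk-Tfrac n = sym (tab-unique a d returns returns-zero returns-suc n 0 ≤-refl)

  -- From sums over subsets to walks

  module _ (w : ℕ → Bool → ℕ → Carrier) where

    -- Transfer-matrix form of a sum over subsets: membership is decided from the last element
    -- backwards, and all that `φ` needs to know of the smaller elements is how many were chosen.
    transfer : ℕ → (ℕ → Carrier) → Carrier
    transfer zero    φ = φ 0
    transfer (suc i) φ = transfer i (λ a → w i true a * φ (suc a) + w i false a * φ a)

    sumB-transfer : ∀ k φ →
      sumB k (λ A → prodL (range k) (λ i → w i (A i) (count i A)) * φ (count k A)) ≈ transfer k φ
    sumB-transfer zero    φ = *-identityˡ _
    sumB-transfer (suc k) φ = trans (sumB-cong k λ A → trans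
        (+-cong (extend A true (ℕₚ.+-comm (count k A) 1)) (extend A false (ℕₚ.+-identityʳ _)))
        (sym (distribˡ _ _ _)))
      (sumB-transfer k _)
      where
      extend : ∀ A b {n} → count k A ℕ.+ ⟦ b ⟧ ≡ n →
        prodL (range (suc k)) (λ i → w i ((A [ k ≔ b ]) i) (count i (A [ k ≔ b ]))) * φ (count (suc k) (A [ k ≔ b ]))
        ≈ prodL (range k) (λ i → w i (A i) (count i A)) * (w k b (count k A) * φ n)
      extend A b {n} e = begin
        w k (A′ k) (count k A′) * prodL (range k) (λ i → w i (A′ i) (count i A′)) * φ (count (suc k) A′)
          ≈⟨ *-cong (*-cong (reflexive (cong₂ (w k) (≔-here A k) (below ≤-refl)))
               (prodL-cong (range k) λ {i} i∈ → let i<k = ∈-range⁻ k i∈ in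
                 reflexive (cong₂ (w i) (≔-there A (<⇒≢ i<k)) (below (ℕₚ.<⇒≤ i<k)))))
               (reflexive (cong φ (≡.trans (cong₂ ℕ._+_ (below ≤-refl) (cong ⟦_⟧ (≔-here A k))) e))) ⟩
        w k b (count k A) * prodL (range k) (λ i → w i (A i) (count i A)) * φ n
          ≈⟨ trans (*-congʳ (*-comm _ _)) (*-assoc _ _ _) ⟩
        prodL (range k) (λ i → w i (A i) (count i A)) * (w k b (count k A) * φ n) ∎
        where
        A′ = A [ k ≔ b ]
        below : ∀ {i} → i ≤ k → count i A′ ≡ count i A
        below {i} i≤k = count-cong i λ j<i → ≔-there A (<⇒≢ (ℕₚ.<-≤-trans j<i i≤k))

    -- After i steps, a of which go down, a walk started at height 1 is at height suc i ∸ dbl a.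
    module _ (up dn : ℕ → Carrier) (dn-0 : dn 0 ≈ 0#)
      (w-up : ∀ i a → dbl a ≤ suc i → w i false a ≈ up (suc i ∸ dbl a))
      (w-dn : ∀ i a → dbl a ≤ suc i → w i true a ≈ dn (suc i ∸ dbl a))
      where

      -- Counts `a` beyond the bound would mean a negative height. They do not matter: the step
      -- leading there starts at height 0 and has weight `dn 0`.
      transfer-cong : ∀ i {φ ψ} → (∀ a → dbl a ≤ suc i → φ a ≈ ψ a) → transfer i φ ≈ transfer i ψ
      transfer-cong zero    e = e 0 z≤n
      transfer-cong (suc i) {φ} {ψ} e = transfer-cong i λ a le →
        +-cong (down a le) (*-congˡ (e a (ℕₚ.m≤n⇒m≤1+n le)))
        where
        down : ∀ a → dbl a ≤ suc i → w i true a * φ (suc a) ≈ w i true a * ψ (suc a)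
        down a le with m≤n⇒m<n∨m≡n le
        ... | inj₁ lt = *-congˡ (e (suc a) (s≤s lt))
        ... | inj₂ eq = trans (trans (*-congʳ w≈0) (zeroˡ _)) (sym (trans (*-congʳ w≈0) (zeroˡ _)))
          where
          w≈0 : w i true a ≈ 0#
          w≈0 = trans (w-dn i a le) (trans (reflexive (cong dn (ℕₚ.m≤n⇒m∸n≡0 (ℕₚ.≤-reflexive (≡.sym eq))))) dn-0)

      -- The last transfer step becomes the first step of the remaining walk, so the walk grows
      -- backwards until it covers all steps.
      transfer-walk : ∀ i N → transfer i (λ a → walk up dn 1 N (suc i ∸ dbl a)) ≈ walk up dn 1 (i ℕ.+ N) 1
      transfer-walk zero    N = refl
      transfer-walk (suc i) N = trans
        (transfer-cong i λ a le → trans (+-comm _ _) (+-cong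
          (*-cong (w-up i a le) (reflexive (cong (walk up dn 1 N) (+-∸-assoc 1 le))))
          (*-cong (w-dn i a le) (reflexive (cong (walk up dn 1 N) (≡.sym (pred[m∸n]≡m∸[1+n] (suc i) (dbl a))))))))
        (trans (transfer-walk i (suc N)) (reflexive (cong (λ m → walk up dn 1 m 1) (ℕₚ.+-suc i N))))

      transfer-balanced : ∀ n → transfer (dbl n) (λ a → if a ≡ᵇ n then 1# else 0#) ≈ walk up dn 1 (dbl n) 1
      transfer-balanced n = trans (transfer-cong (dbl n) balanced) (trans (transfer-walk (dbl n) 0)
          (reflexive (cong (λ m → walk up dn 1 m 1) (ℕₚ.+-identityʳ (dbl n)))))
        where
        balanced : ∀ a → dbl a ≤ suc (dbl n) → (if a ≡ᵇ n then 1# else 0#) ≈ walk up dn 1 0 (suc (dbl n) ∸ dbl a)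
        balanced a le = reflexive (cong (λ b → if b then 1# else 0#)
          (≡.trans (same a≤n)
            (cong (_≡ᵇ 1) (≡.sym (≡.trans (+-∸-assoc 1 (dbl-mono-≤ a≤n)) (cong suc (dbl-∸ n a)))))))
          where
          a≤n : a ≤ n
          a≤n = dbl-≤-suc le
          same : ∀ {a n} → a ≤ n → (a ≡ᵇ n) ≡ (suc (dbl (n ∸ a)) ≡ᵇ 1)
          same {n = zero}  z≤n     = ≡.refl
          same {n = suc n} z≤n     = ≡.refl
          same             (s≤s p) = same p

-- Eligible values, the filling order and the resulting counts

-- A stands for the set of values taken at the even (0-based) positions.
eligible : (m : ℕ) → (ℕ → Bool) → ℕ → ℕ → Bool
eligible m A i v =
  (v <ᵇ m) ∧ (if isEven i then A v ∧ (i ≤ᵇ v) else not (A v) ∧ (v ≤ᵇ i))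

-- Even positions are filled from right to left, odd ones from left to right.
earlier : ℕ → ℕ → Bool
earlier i j = if isEven i then isEven j ∧ (i <ᵇ j) else not (isEven j) ∧ (j <ᵇ i)

eligible-bound : ∀ m A i v → T (eligible m A i v) → v < m
eligible-bound m A i v t = <ᵇ⇒< v m (∧ˡ t)

-- An earlier even position lies to the right and has the stronger lower bound; an earlier odd
-- position lies to the left and has the stronger upper bound.
eligible-mono : ∀ m A i j v → T (earlier i j) → T (eligible m A j v) → T (eligible m A i v)
eligible-mono m A i j v d t with isEven i | isEven j | ∧ʳ {v <ᵇ m} t
... | true  | true  | t′ = ∧ˡ {v <ᵇ m} t & ∧ˡ {A v} t′ &
  ≤⇒≤ᵇ (ℕₚ.≤-trans (ℕₚ.<⇒≤ (<ᵇ⇒< i j d)) (≤ᵇ⇒≤ j v (∧ʳ {A v} t′)))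
... | false | false | t′ = ∧ˡ {v <ᵇ m} t & ∧ˡ {not (A v)} t′ &
  ≤⇒≤ᵇ (ℕₚ.≤-trans (≤ᵇ⇒≤ v j (∧ʳ {not (A v)} t′)) (ℕₚ.<⇒≤ (<ᵇ⇒< j i d)))

earlier-irrefl : ∀ i → ¬ T (earlier i i)
earlier-irrefl i d with isEven i
... | true  = ℕₚ.n≮n i (<ᵇ⇒< i i d)
... | false = ℕₚ.n≮n i (<ᵇ⇒< i i d)

earlier-total : ∀ i j k → T (earlier i j) → T (earlier i k) → j ≢ k → T (earlier j k) ⊎ T (earlier k j)
earlier-total i j k dj dk j≢k with isEven i | isEven j | isEven k | ℕₚ.<-cmp j k
... | _     | _     | _     | tri≈ _ j≡k _ = ⊥-elim (j≢k j≡k)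
... | true  | true  | true  | tri< j<k _ _ = inj₁ (<⇒<ᵇ j<k)
... | true  | true  | true  | tri> _ _ k<j = inj₂ (<⇒<ᵇ k<j)
... | false | false | false | tri< j<k _ _ = inj₂ (<⇒<ᵇ j<k)
... | false | false | false | tri> _ _ k<j = inj₁ (<⇒<ᵇ k<j)

-- The list is 2n-2, ..., 2, 0, 1, 3, ..., 2n-1. The two parities do not constrain each other, so
-- this nesting is chosen for its simple recursion.
order : ℕ → List ℕ
order zero    = []
order (suc n) = dbl n ∷ (order n ++ suc (dbl n) ∷ [])

order-↭ : ∀ n → order n ↭ range (dbl n)
order-↭ zero    = ↭-refl
order-↭ (suc n) = ↭-trans
  (prep (dbl n) (↭-trans (↭ₚ.++-comm (order n) _) (prep _ (order-↭ n)))) (swap _ _ ↭-refl)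

order-< : ∀ n → All (_< dbl n) (order n)
order-< n = ↭ₚ.All-resp-↭ (↭-sym (order-↭ n)) (All.tabulate (∈-range⁻ (dbl n)))

order-earlier : ∀ n → AllPairs (λ i j → i ≢ j × ¬ T (earlier i j)) (order n)
order-earlier zero    = []
order-earlier (suc n) =
  Allₚ.++⁺ (All.map first (order-< n)) ((<⇒≢ (n<1+n (dbl n)) , notOdd) ∷ [])
  ∷ AllPairsₚ.++⁺ (order-earlier n) ([] ∷ []) (All.map (λ i< → last i< ∷ []) (order-< n))
  where
  first : ∀ {j} → j < dbl n → dbl n ≢ j × ¬ T (earlier (dbl n) j)
  first {j} j< = (λ e → <⇒≢ j< (≡.sym e)) , late
    where
    late : ¬ T (earlier (dbl n) j)
    late t rewrite isEven-dbl n = <⇒≱ (<ᵇ⇒< (dbl n) j (∧ʳ {isEven j} t)) (ℕₚ.<⇒≤ j<)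
  notOdd : ¬ T (earlier (dbl n) (suc (dbl n)))
  notOdd t rewrite isEven-dbl n | isEven-1+dbl n = t
  last : ∀ {i} → i < dbl n → i ≢ suc (dbl n) × ¬ T (earlier i (suc (dbl n)))
  last {i} i< = <⇒≢ (m<n⇒m<1+n i<) , late
    where
    late : ¬ T (earlier i (suc (dbl n)))
    late t rewrite isEven-1+dbl n with isEven i
    ... | false = <⇒≱ (<ᵇ⇒< (suc (dbl n)) i t) (ℕₚ.<⇒≤ (m<n⇒m<1+n i<))

count-earlier-even : ∀ {n s} → s < n → count (dbl n) (earlier (dbl s)) ℕ.+ suc s ≡ n
count-earlier-even {n} {s} s<n = ≡.trans (cong₂ ℕ._+_ (count-cong m λ {j} _ → unfold j) evens)
    (≡.trans (≡.sym (count-+ m {isEven} {later} {λ j → (j <ᵇ suc (dbl s)) ∧ isEven j} λ {j} _ → split j)) (count-even n))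
  where
  m = dbl n
  later : ℕ → Bool
  later j = isEven j ∧ (dbl s <ᵇ j)
  unfold : ∀ j → earlier (dbl s) j ≡ later j
  unfold j rewrite isEven-dbl s = ≡.refl
  evens : suc s ≡ count m (λ j → (j <ᵇ suc (dbl s)) ∧ isEven j)
  evens = ≡.sym (≡.trans (count-prefix isEven (ℕₚ.≤-trans (ℕₚ.n≤1+n _) (dbl-mono-≤ s<n))) last)
    where
    last : count (suc (dbl s)) isEven ≡ suc s
    last rewrite isEven-dbl s | count-even s = ℕₚ.+-comm s 1
  split : ∀ j → ⟦ isEven j ⟧ ≡ ⟦ later j ⟧ ℕ.+ ⟦ (j <ᵇ suc (dbl s)) ∧ isEven j ⟧
  split j with isEven j | dbl s <ᵇ j in e | j <ᵇ suc (dbl s) in e′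
  ... | false | _     | true  = ≡.refl
  ... | false | _     | false = ≡.refl
  ... | true  | true  | false = ≡.refl
  ... | true  | false | true  = ≡.refl
  ... | true  | true  | true  =
    ⊥-elim (<⇒≱ (<ᵇ⇒< _ j (≡true⇒T e)) (ℕₚ.≤-pred (<ᵇ⇒< j _ (≡true⇒T e′))))
  ... | true  | false | false =
    ⊥-elim (≡false⇒¬T e′ (<⇒<ᵇ (s≤s (<ᵇ-false (dbl s) j e))))

count-earlier-odd : ∀ {n s} → s < n → count (dbl n) (earlier (suc (dbl s))) ≡ s
count-earlier-odd {n} {s} s<n = ≡.trans (count-cong (dbl n) λ {j} _ → unfold j)
    (≡.trans (count-prefix (not ∘ isEven) (ℕₚ.≤-trans (ℕₚ.n≤1+n _) (dbl-mono-≤ s<n))) odds)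
  where
  unfold : ∀ j → earlier (suc (dbl s)) j ≡ ((j <ᵇ suc (dbl s)) ∧ not (isEven j))
  unfold j rewrite isEven-1+dbl s with isEven j | j <ᵇ suc (dbl s)
  ... | true  | true  = ≡.refl
  ... | true  | false = ≡.refl
  ... | false | true  = ≡.refl
  ... | false | false = ≡.refl
  odds : count (suc (dbl s)) (not ∘ isEven) ≡ s
  odds rewrite isEven-dbl s | count-odd s = ℕₚ.+-identityʳ s

count-eligible-even : ∀ {n s} A → s < n →
  count (dbl n) (eligible (dbl n) A (dbl s)) ℕ.+ count (dbl s) A ≡ count (dbl n) A
count-eligible-even {n} {s} A s<n =
  ≡.trans (cong (count m (eligible m A (dbl s)) ℕ.+_) (≡.sym (count-prefix A (dbl-mono-≤ (ℕₚ.<⇒≤ s<n)))))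
    (≡.sym (count-+ m λ {v} → split v))
  where
  m = dbl n
  split : ∀ v → v < m → ⟦ A v ⟧ ≡ ⟦ eligible m A (dbl s) v ⟧ ℕ.+ ⟦ (v <ᵇ dbl s) ∧ A v ⟧
  split v v<m rewrite T⇒≡true (<⇒<ᵇ v<m) | isEven-dbl s with A v | dbl s ≤ᵇ v in e | v <ᵇ dbl s in e′
  ... | false | _     | true  = ≡.refl
  ... | false | _     | false = ≡.refl
  ... | true  | true  | false = ≡.refl
  ... | true  | false | true  = ≡.refl
  ... | true  | true  | true  =
    ⊥-elim (<⇒≱ (<ᵇ⇒< v (dbl s) (≡true⇒T e′)) (≤ᵇ⇒≤ (dbl s) v (≡true⇒T e)))
  ... | true  | false | false =
    ⊥-elim (≡false⇒¬T e (≤⇒≤ᵇ (<ᵇ-false v (dbl s) e′)))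

count-eligible-odd : ∀ {n s} A → s < n →
  count (dbl n) (eligible (dbl n) A (suc (dbl s))) ℕ.+ count (dbl (suc s)) A ≡ dbl (suc s)
count-eligible-odd {n} {s} A s<n = ≡.trans
    (cong (ℕ._+ count k A) (≡.trans (count-cong m λ {v} → unfold v) (count-prefix (not ∘ A) (dbl-mono-≤ s<n))))
    (≡.trans (≡.sym (count-+ k {const true} λ {v} _ → split (A v))) (count-true k))
  where
  m = dbl n
  k = dbl (suc s)
  unfold : ∀ v → v < m → eligible m A (suc (dbl s)) v ≡ ((v <ᵇ k) ∧ not (A v))
  unfold v v<m rewrite T⇒≡true (<⇒<ᵇ v<m) | isEven-1+dbl s = T-iff
    (λ t → <⇒<ᵇ (s≤s (≤ᵇ⇒≤ v _ (∧ʳ {not (A v)} t))) & ∧ˡ {not (A v)} t)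
    (λ t → ∧ʳ {v <ᵇ k} t & ≤⇒≤ᵇ (ℕₚ.≤-pred (<ᵇ⇒< v k (∧ˡ {v <ᵇ k} t))))
  split : ∀ b → 1 ≡ ⟦ not b ⟧ ℕ.+ ⟦ b ⟧
  split true  = ≡.refl
  split false = ≡.refl

-- Here `x` is a number of eligible values and `e` of earlier positions, so the left side counts
-- available values; the right side expresses it by the steps of the path. The identity holds for
-- truncated subtraction, which is why the preceding counts are phrased additively.
∸-exchange : ∀ x a e t → x ℕ.+ a ≡ e ℕ.+ t → x ∸ e ≡ t ∸ a
∸-exchange x a e t eq = ≡.trans (≡.sym (ℕₚ.[m+n]∸[m+o]≡n∸o a x e))
  (≡.trans (cong₂ _∸_ (≡.trans (ℕₚ.+-comm a x) eq) (ℕₚ.+-comm a e)) (ℕₚ.[m+n]∸[m+o]≡n∸o e t a))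

-- Local weights and the coefficients of the fraction

module Labels {c ℓ} (R : CommutativeRing c ℓ) where
  open CommutativeRing R
  open Sums R
  open Walks R
  open import Relation.Binary.Reasoning.Setoid setoid
  open import Algebra.Properties.CommutativeSemigroup *-commutativeSemigroup
    using () renaming (x∙yz≈y∙xz to x*yz≈y*xz)

  -- The exponents `a` and `b` count crossings and nestings. An excedance is a record, and an
  -- anti-excedance an antirecord, exactly when it is nested in nothing, whence the test `b ≡ᵇ 0`.
  arc : (p q y u : Carrier) → ℕ → ℕ → Carrier
  arc p q y u a b = pow R p a * pow R q b * (if b ≡ᵇ 0 then y else u)

  -- Fields with index 1 belong to cycle valleys (peaks), those with index 2 to cycle
  -- double rises (falls), and s, w, z to the fixed points.
  record Side : Set c where
    field
      p₁ q₁ y₁ u₁ p₂ q₂ y₂ u₂ s w z : Carrier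

  module _ (S : Side) where
    open Side S

    fixed : ℕ → Carrier
    fixed zero    = z
    fixed (suc k) = pow R s (suc k) * w

    -- The weight of a position with N available values, r of which are crossed;
    -- the flag tells whether the position itself is one of these values, in which case r = 0
    -- means a fixed point.
    label : Bool → ℕ → ℕ → Carrier
    label false N r       = arc p₁ q₁ y₁ u₁ r (N ∸ 1 ∸ r)
    label true  N zero    = fixed (N ∸ 1)
    label true  N (suc r) = arc p₂ q₂ y₂ u₂ r (N ∸ 2 ∸ r)

    labels : Bool → ℕ → Carrier
    labels b N = sumR R N (label b N)

  -- Only `r = k` has no nesting and carries `y`. Every other term contains a factor `q`, and what
  -- is left after splitting it off is a term of the `p`,`q`-integer.
  sum-arc : ∀ p q y u k →
    sumR R (suc k) (λ r → arc p q y u r (k ∸ r)) ≈ pow R p k * y + q * qint R p q k * u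
  sum-arc p q y u k = trans (+-cong crossing last) (+-comm _ _)
    where
    last : arc p q y u k (k ∸ k) ≈ pow R p k * y
    last rewrite n∸n≡0 k = *-congʳ (*-identityʳ _)
    crossing : sumR R k (λ r → arc p q y u r (k ∸ r)) ≈ q * qint R p q k * u
    crossing = trans (sumR-cong k step) (trans (sumR-*ʳ k) (*-congʳ (sumR-*ˡ k)))
      where
      step : ∀ {r} → r < k → arc p q y u r (k ∸ r) ≈ q * (pow R p r * pow R q (k ∸ 1 ∸ r)) * u
      step {r} (s≤s {n = k′} r≤k′) rewrite +-∸-assoc 1 r≤k′ = *-congʳ (x*yz≈y*xz _ _ _)

  module _ (S : Side) where
    open Side S

    labels-false : ∀ k → labels S false (suc k) ≈ pow R p₁ k * y₁ + q₁ * qint R p₁ q₁ k * u₁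
    labels-false = sum-arc p₁ q₁ y₁ u₁

    labels-true-1 : labels S true 1 ≈ z
    labels-true-1 = +-identityˡ z

    labels-true : ∀ k → labels S true (suc (suc k))
      ≈ pow R p₂ k * y₂ + q₂ * qint R p₂ q₂ k * u₂ + pow R s (suc k) * w
    labels-true k = trans (sumR-head (suc k)) (trans (+-comm _ _) (+-congʳ (sum-arc p₂ q₂ y₂ u₂ k)))

  module Steps (v : Vars R) where
    open Vars v

    -- Rising positions have odd index in the 1-based numbering, so they receive the odd variables.
    upper lower : Side
    upper = record
      { p₁ = p₊₁ ; q₁ = q₊₁ ; y₁ = y₁ ; u₁ = v₁
      ; p₂ = p₊₂ ; q₂ = q₊₂ ; y₂ = y₂ ; u₂ = v₂
      ; s = sₒ ; w = wₒ ; z = zₒ }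
    lower = record
      { p₁ = p₋₁ ; q₁ = q₋₁ ; y₁ = x₁ ; u₁ = u₁
      ; p₂ = p₋₂ ; q₂ = q₋₂ ; y₂ = x₂ ; u₂ = u₂
      ; s = sₑ ; w = wₑ ; z = zₑ }

    -- Heights are shifted by one: the path dips to height 0 at an odd record-antirecord.
    up dn : ℕ → Carrier
    up g = if isEven g then labels lower true (suc ⌊ g /2⌋) else labels upper false (suc ⌊ g /2⌋)
    dn g = if isEven g then labels lower false ⌊ g /2⌋ else labels upper true (suc ⌊ g /2⌋)

    up-even : ∀ k → up (dbl k) ≡ labels lower true (suc k)
    up-even k rewrite isEven-dbl k | ⌊dbl/2⌋ k = ≡.refl

    up-odd : ∀ k → up (suc (dbl k)) ≡ labels upper false (suc k)
    up-odd k rewrite isEven-1+dbl k | ⌊1+dbl/2⌋ k = ≡.refl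

    dn-even : ∀ k → dn (dbl k) ≡ labels lower false k
    dn-even k rewrite isEven-dbl k | ⌊dbl/2⌋ k = ≡.refl

    dn-odd : ∀ k → dn (suc (dbl k)) ≡ labels upper true (suc k)
    dn-odd k rewrite isEven-1+dbl k | ⌊1+dbl/2⌋ k = ≡.refl

    -- From an odd height, the up step is a cycle valley and the matching down step a cycle peak.
    -- From an even height, the up step is a cycle double fall or an even fixed point, the down step
    -- a cycle double rise or an odd fixed point.
    α-up-dn : ∀ k → α R v (suc k) ≈ up (suc k) * dn (suc (suc k))
    α-up-dn k with parity k
    ... | even k′ rewrite isEven-dbl k′ | ⌊dbl/2⌋ k′ | isEven-1+dbl k′ | ⌊1+dbl/2⌋ k′ =
      trans (*-comm _ _) (sym (*-cong (labels-false upper k′) (labels-false lower k′)))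
    ... | odd k′ rewrite isEven-1+dbl k′ | ⌊1+dbl/2⌋ k′ | isEven-dbl k′ | ⌊dbl/2⌋ k′ =
      sym (*-cong (labels-true lower k′) (labels-true upper k′))

    -- Both steps of the dip have a single available value, the position itself, and so are
    -- record-antirecords.
    δ₁-dip : δ R v 1 ≈ dn 1 * up 0
    δ₁-dip = trans (*-comm _ _) (sym (*-cong (labels-true-1 upper) (labels-true-1 lower)))

    -- Weight of the step at i of a path having made a down steps; b tells whether it goes down.
    step : ℕ → Bool → ℕ → Carrier
    step i b a = if isEven i
      then labels upper b (suc ⌊ i /2⌋ ∸ a)
      -- At an odd position the eligible values are those up to and including `i` outside `A`, so
      -- the step at `i` itself affects their number. At an even one the elements of `A` from `i` on
      -- are counted through those strictly before `i`.
      else labels lower (not b) (suc (suc ⌊ i /2⌋) ∸ (a ℕ.+ ⟦ b ⟧))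

    step-up : ∀ i a → dbl a ≤ suc i → step i false a ≈ up (suc i ∸ dbl a)
    step-up i a le with parity i
    ... | even s rewrite isEven-dbl s | ⌊dbl/2⌋ s
                       | +-∸-assoc 1 (dbl-mono-≤ (dbl-≤-suc {a} {s} le)) | dbl-∸ s a
                       | +-∸-assoc 1 (dbl-≤-suc {a} {s} le) = reflexive (≡.sym (up-odd (s ∸ a)))
    ... | odd s rewrite isEven-1+dbl s | ⌊1+dbl/2⌋ s | dbl-∸ (suc s) a | ℕₚ.+-identityʳ a
                      | +-∸-assoc 1 (dbl-cancel-≤ {a} {suc s} le) = reflexive (≡.sym (up-even (suc s ∸ a)))

    step-dn : ∀ i a → dbl a ≤ suc i → step i true a ≈ dn (suc i ∸ dbl a)
    step-dn i a le with parity i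
    ... | even s rewrite isEven-dbl s | ⌊dbl/2⌋ s
                       | +-∸-assoc 1 (dbl-mono-≤ (dbl-≤-suc {a} {s} le)) | dbl-∸ s a
                       | +-∸-assoc 1 (dbl-≤-suc {a} {s} le) = reflexive (≡.sym (dn-odd (s ∸ a)))
    ... | odd s rewrite isEven-1+dbl s | ⌊1+dbl/2⌋ s | dbl-∸ (suc s) a | ℕₚ.+-comm a 1 =
      reflexive (≡.sym (dn-even (suc s ∸ a)))

    paths-Tfrac : ∀ n →
      sumB (dbl n) (λ A → prodL (range (dbl n)) (λ i → step i (A i) (count i A))
                        * (if count (dbl n) A ≡ᵇ n then 1# else 0#))
      ≈ Tfrac R (α R v) (δ R v) n
    paths-Tfrac n = trans (sumB-transfer step (dbl n) (λ a → if a ≡ᵇ n then 1# else 0#))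
      (trans (transfer-balanced step up dn refl step-up step-dn n)
        (walk-Tfrac up dn (α R v) (δ R v) refl α-up-dn δ₁-dip (λ _ → refl) n))

    -- A rank counts smaller available values. They account for crossings on the rising side but for
    -- nestings on the falling side, which therefore uses the complementary rank.
    rank-weight : (ℕ → Bool) → ℕ → ℕ → ℕ → Carrier
    rank-weight A i N r = if isEven i then label upper (A i) N r else label lower (not (A i)) N (N ∸ 1 ∸ r)

    module Fill (m : ℕ) (A : ℕ → Bool) =
      Filling m (eligible m A) earlier (rank-weight A)
        (eligible-bound m A) (eligible-mono m A) earlier-irrefl earlier-total

    total-step : ∀ n A {i} → i < dbl n → count (dbl n) A ≡ n →
      Fill.total (dbl n) A i ≈ step i (A i) (count i A)
    total-step n A {i} i<m balanced with parity i
    ... | even s = begin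
      sumR R N (rank-weight A (dbl s) N)
        ≡⟨ cong (sumR R N) (rw N) ⟩
      labels upper (A (dbl s)) N
        ≡⟨ cong (labels upper (A (dbl s))) N≡ ⟩
      labels upper (A (dbl s)) (suc s ∸ count (dbl s) A)
        ≡⟨ st ⟨
      step (dbl s) (A (dbl s)) (count (dbl s) A) ∎
      where
      s<n : s < n
      s<n = dbl-cancel-< i<m
      e = count (dbl n) (earlier (dbl s))
      N = count (dbl n) (eligible (dbl n) A (dbl s)) ∸ e
      rw : ∀ N → rank-weight A (dbl s) N ≡ label upper (A (dbl s)) N
      rw N rewrite isEven-dbl s = ≡.refl
      st : step (dbl s) (A (dbl s)) (count (dbl s) A) ≡ labels upper (A (dbl s)) (suc s ∸ count (dbl s) A)
      st rewrite isEven-dbl s | ⌊dbl/2⌋ s = ≡.refl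
      N≡ : N ≡ suc s ∸ count (dbl s) A
      N≡ = ∸-exchange _ (count (dbl s) A) e (suc s)
        (≡.trans (count-eligible-even A s<n) (≡.trans balanced (≡.sym (count-earlier-even s<n))))
    ... | odd s = begin
      sumR R N (rank-weight A i′ N)
        ≡⟨ cong (sumR R N) (rw N) ⟩
      sumR R N (λ r → label lower (not (A i′)) N (N ∸ 1 ∸ r))
        ≈⟨ sumR-reverse N ⟩
      labels lower (not (A i′)) N
        ≡⟨ cong (labels lower (not (A i′))) N≡ ⟩
      labels lower (not (A i′)) (suc (suc s) ∸ count (suc i′) A)
        ≡⟨ st ⟨
      step i′ (A i′) (count i′ A) ∎
      where
      i′ = suc (dbl s)
      s<n : s < n
      s<n = dbl-cancel-< (ℕₚ.<-trans (n<1+n _) i<m)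
      N = count (dbl n) (eligible (dbl n) A i′) ∸ count (dbl n) (earlier i′)
      rw : ∀ N → rank-weight A i′ N ≡ (λ r → label lower (not (A i′)) N (N ∸ 1 ∸ r))
      rw N rewrite isEven-1+dbl s = ≡.refl
      st : step i′ (A i′) (count i′ A) ≡ labels lower (not (A i′)) (suc (suc s) ∸ count (suc i′) A)
      st rewrite isEven-1+dbl s | ⌊1+dbl/2⌋ s = ≡.refl
      N≡ : N ≡ suc (suc s) ∸ count (suc i′) A
      N≡ = ∸-exchange _ (count (suc i′) A) (count (dbl n) (earlier i′)) (suc (suc s))
        (≡.trans (count-eligible-odd A s<n) (≡.trans (cong (suc ∘ suc) (dbl≡ s))
          (≡.trans (≡.sym (≡.trans (ℕₚ.+-suc s (suc s)) (cong suc (ℕₚ.+-suc s s))))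
            (cong (ℕ._+ suc (suc s)) (≡.sym (count-earlier-odd s<n))))))

-- D-permutations: records, crossings, nestings and ranks

module DPermutations where
  open import Data.Nat.Base using (_+_)
  open import Data.Nat.Properties
  open import Relation.Binary.PropositionalEquality

  <ᵇ-true : ∀ {m n} → m < n → (m <ᵇ n) ≡ true
  <ᵇ-true m<n = T⇒≡true (<⇒<ᵇ m<n)

  ≮ᵇ : ∀ {m n} → n ≤ m → (m <ᵇ n) ≡ false
  ≮ᵇ {m} {n} n≤m = ¬T⇒≡false λ t → <⇒≱ (<ᵇ⇒< m n t) n≤m

  ≤ᵇ-true : ∀ {m n} → m ≤ n → (m ≤ᵇ n) ≡ true
  ≤ᵇ-true m≤n = T⇒≡true (≤⇒≤ᵇ m≤n)

  ≰ᵇ : ∀ {m n} → n < m → (m ≤ᵇ n) ≡ false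
  ≰ᵇ {m} {n} n<m = ¬T⇒≡false λ t → <⇒≱ n<m (≤ᵇ⇒≤ m n t)

  record DPermutes (m : ℕ) (f : ℕ → ℕ) : Set where
    field
      permutes : Permutes m f
      rises    : ∀ {i} → i < m → T (isEven i) → i ≤ f i
      falls    : ∀ {i} → i < m → ¬ T (isEven i) → f i ≤ i
    open Permutes permutes public

  module _ {m : ℕ} {f : ℕ → ℕ} where
    open Perm m f

    isD⁻ : T isD → DPermutes m f
    isD⁻ t = record
      { permutes = record
        { bounded   = λ {i} i<m → <ᵇ⇒< (f i) m (allB⁻ m (∧ˡ t₁) i<m)
        ; injective = injective
        }
      ; rises = rises
      ; falls = falls
      }
      where
      t₁ : T isPerm
      t₁ = ∧ˡ t
      t₂ : ∀ {i} → i < m → T (if isEven i then i ≤ᵇ f i else f i ≤ᵇ i)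
      t₂ = allB⁻ m (∧ʳ {isPerm} t)
      distinct : ∀ {i j} → i < m → j < i → f i ≢ f j
      distinct {i} {j} i<m j<i e =
        T-not⁻ (allB⁻ i (allB⁻ m (∧ʳ {allB m (λ k → f k <ᵇ m)} t₁) i<m) j<i) (≡⇒≡ᵇ (f i) (f j) e)
      injective : ∀ {i j} → i < m → j < m → f i ≡ f j → i ≡ j
      injective {i} {j} i<m j<m e with <-cmp i j
      ... | tri< i<j _ _ = ⊥-elim (distinct j<m i<j (sym e))
      ... | tri≈ _ i≡j _ = i≡j
      ... | tri> _ _ j<i = ⊥-elim (distinct i<m j<i e)
      rises : ∀ {i} → i < m → T (isEven i) → i ≤ f i
      rises {i} i<m ev with isEven i | t₂ i<m
      ... | true | t′ = ≤ᵇ⇒≤ i (f i) t′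
      falls : ∀ {i} → i < m → ¬ T (isEven i) → f i ≤ i
      falls {i} i<m od with isEven i | t₂ i<m
      ... | true  | _  = ⊥-elim (od _)
      ... | false | t′ = ≤ᵇ⇒≤ (f i) i t′

    isD⁺ : DPermutes m f → T isD
    isD⁺ dp = (allB⁺ m (<⇒<ᵇ ∘ bounded) & allB⁺ m (λ {i} i<m → allB⁺ i λ {j} j<i → T-not⁺ λ t →
        <⇒≢ j<i (sym (injective i<m (<-trans j<i i<m) (≡ᵇ⇒≡ (f i) (f j) t))))) & allB⁺ m bound
      where
      open DPermutes dp
      bound : ∀ {i} → i < m → T (if isEven i then i ≤ᵇ f i else f i ≤ᵇ i)
      bound {i} i<m with isEven i | rises i<m | falls i<m
      ... | true  | r | _ = ≤⇒≤ᵇ (r _)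
      ... | false | _ | l = ≤⇒≤ᵇ (l λ ())

  upperValues : ℕ → (ℕ → ℕ) → ℕ → Bool
  upperValues m f v = anyB m (λ j → isEven j ∧ (f j ≡ᵇ v))

  module DPermutation {m : ℕ} {f : ℕ → ℕ} (dp : DPermutes m f) where
    open DPermutes dp
    open Perm m f

    private A₀ = upperValues m f

    upperValues-∘ : ∀ {i} → i < m → A₀ (f i) ≡ isEven i
    upperValues-∘ {i} i<m = T-iff
      (λ t → let j , j<m , t′ = anyB⁻ m t
             in subst (T ∘ isEven) (injective j<m i<m (≡ᵇ⇒≡ (f j) (f i) (∧ʳ {isEven j} t′))) (∧ˡ t′))
      (λ ev → anyB⁺ m i<m (ev & ≡⇒≡ᵇ (f i) (f i) refl))

    upperValues-left : ∀ {i k} → k < m → f k ≡ i → k < i → A₀ i ≡ true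
    upperValues-left {k = k} k<m refl k<i = trans (upperValues-∘ k<m)
      (T⇒≡true (decidable-stable (T? (isEven k)) λ ¬ev → <⇒≱ k<i (falls k<m ¬ev)))

    upperValues-right : ∀ {i k} → k < m → f k ≡ i → i < k → A₀ i ≡ false
    upperValues-right k<m refl i<k = trans (upperValues-∘ k<m)
      (¬T⇒≡false λ ev → <⇒≱ i<k (rises k<m ev))

    count-upperValues : count m A₀ ≡ count m isEven
    count-upperValues = trans (sym (count-∘ A₀)) (count-cong m upperValues-∘)

    -- The first two count the inversions at `i` and become the nestings. The last two become the
    -- crossings, except that their weak inequality also admits the value `i`, that is, the preimage
    -- of `i`.
    invL invR innL innR : ℕ → ℕ
    invL i = count i (λ j → f i <ᵇ f j)
    invR i = count m (λ j → (i <ᵇ j) ∧ (f j <ᵇ f i))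
    innL i = count i (λ j → (f j <ᵇ f i) ∧ (i ≤ᵇ f j))
    innR i = count m (λ j → (i <ᵇ j) ∧ ((f i <ᵇ f j) ∧ (f j ≤ᵇ i)))

    f-≢ : ∀ {i j} → i < m → j < m → i ≢ j → f i ≢ f j
    f-≢ i<m j<m i≢j e = i≢j (injective i<m j<m e)

    -- Exactly `f i` positions have a smaller value: those left of `i`, which are `i` minus `invL i`
    -- many, and the `invR i` ones on the right. So excedances are no antirecords, anti-excedances
    -- no records, and a fixed point is a record exactly when it is an antirecord.
    inversions : ∀ {i} → i < m → f i + invL i ≡ i + invR i
    inversions {i} i<m = begin
      f i + invL i                  ≡⟨ cong (_+ invL i) smaller ⟨
      count m (λ j → f j <ᵇ f i) + invL i ≡⟨ cong (_+ invL i) (count-+ m λ {j} _ → split j) ⟩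
      count m (λ j → (j <ᵇ i) ∧ (f j <ᵇ f i)) + invR i + invL i
        ≡⟨ cong (λ x → x + invR i + invL i) (count-prefix (λ j → f j <ᵇ f i) (<⇒≤ i<m)) ⟩
      count i (λ j → f j <ᵇ f i) + invR i + invL i ≡⟨ +-assoc _ (invR i) (invL i) ⟩
      count i (λ j → f j <ᵇ f i) + (invR i + invL i) ≡⟨ cong (count i (λ j → f j <ᵇ f i) +_) (+-comm (invR i) _) ⟩
      count i (λ j → f j <ᵇ f i) + (invL i + invR i) ≡⟨ +-assoc _ (invL i) (invR i) ⟨
      count i (λ j → f j <ᵇ f i) + invL i + invR i
        ≡⟨ cong (_+ invR i) (trans (sym (count-+ i {const true} λ {j} → compare j)) (count-true i)) ⟩
      i + invR i ∎
      where
      open ≡-Reasoning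
      smaller : count m (λ j → f j <ᵇ f i) ≡ f i
      smaller = trans (count-∘ (λ v → v <ᵇ f i))
        (trans (count-cong m λ {v} _ → sym (∧-identityʳ (v <ᵇ f i)))
          (trans (count-prefix (const true) (<⇒≤ (bounded i<m))) (count-true (f i))))
      split : ∀ j → ⟦ f j <ᵇ f i ⟧ ≡ ⟦ (j <ᵇ i) ∧ (f j <ᵇ f i) ⟧ + ⟦ (i <ᵇ j) ∧ (f j <ᵇ f i) ⟧
      split j with <-cmp j i
      ... | tri< j<i _ i≮j rewrite <ᵇ-true j<i | ≮ᵇ (<⇒≤ j<i) = sym (+-identityʳ _)
      ... | tri≈ _ refl _ rewrite ≮ᵇ (≤-refl {f j}) | ∧-zeroʳ (j <ᵇ j) = refl
      ... | tri> _ _ i<j rewrite <ᵇ-true i<j | ≮ᵇ (<⇒≤ i<j) = refl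
      compare : ∀ j → j < i → 1 ≡ ⟦ f j <ᵇ f i ⟧ + ⟦ f i <ᵇ f j ⟧
      compare j j<i with <-cmp (f j) (f i)
      ... | tri< lt _ _ rewrite <ᵇ-true lt | ≮ᵇ (<⇒≤ lt) = refl
      ... | tri≈ _ e _  = ⊥-elim (f-≢ (<-trans j<i i<m) i<m (<⇒≢ j<i) e)
      ... | tri> _ _ gt rewrite <ᵇ-true gt | ≮ᵇ (<⇒≤ gt) = refl

    rec≡ : ∀ {i} → i < m → rec i ≡ (invL i ≡ᵇ 0)
    rec≡ {i} i<m = T-iff
      (λ t → ≡⇒≡ᵇ (invL i) 0 (count≡0⁺ i λ {j} j<i t′ →
        <-asym (<ᵇ⇒< (f i) (f j) t′) (<ᵇ⇒< (f j) (f i) (allB⁻ i t j<i))))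
      (λ t → allB⁺ i λ {j} j<i → <⇒<ᵇ (≤∧≢⇒<
        (≮⇒≥ λ lt → count≡0⁻ i (≡ᵇ⇒≡ (invL i) 0 t) j<i (<⇒<ᵇ lt))
        (f-≢ (<-trans j<i i<m) i<m (<⇒≢ j<i))))

    arec≡ : ∀ {i} → i < m → arec i ≡ (invR i ≡ᵇ 0)
    arec≡ {i} i<m = T-iff
      (λ t → ≡⇒≡ᵇ (invR i) 0 (count≡0⁺ m λ {j} j<m t′ → later j t′ (Equivalence.to (T-∨ {j ≤ᵇ i}) (allB⁻ m t j<m))))
      (λ t → allB⁺ m λ {j} j<m → Equivalence.from (T-∨ {j ≤ᵇ i}) (above t j<m))
      where
      later : ∀ j → T ((i <ᵇ j) ∧ (f j <ᵇ f i)) → ¬ (T (j ≤ᵇ i) ⊎ T (f i <ᵇ f j))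
      later j t (inj₁ t′) = <⇒≱ (<ᵇ⇒< i j (∧ˡ t)) (≤ᵇ⇒≤ j i t′)
      later j t (inj₂ t′) = <-asym (<ᵇ⇒< (f i) (f j) t′) (<ᵇ⇒< (f j) (f i) (∧ʳ {i <ᵇ j} t))
      above : T (invR i ≡ᵇ 0) → ∀ {j} → j < m → T (j ≤ᵇ i) ⊎ T (f i <ᵇ f j)
      above t {j} j<m with <-≤-connex i j
      ... | inj₂ j≤i = inj₁ (≤⇒≤ᵇ j≤i)
      ... | inj₁ i<j = inj₂ (<⇒<ᵇ (≤∧≢⇒< (≮⇒≥ λ lt →
                         count≡0⁻ m (≡ᵇ⇒≡ (invR i) 0 t) j<m (<⇒<ᵇ i<j & <⇒<ᵇ lt))
                         (f-≢ i<m j<m (<⇒≢ i<j))))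

    ≡ᵇ-0-false : ∀ {n} → 0 < n → (n ≡ᵇ 0) ≡ false
    ≡ᵇ-0-false (s≤s _) = refl

    arec-excedance : ∀ {i} → i < m → i < f i → arec i ≡ false
    arec-excedance {i} i<m i<fi = trans (arec≡ i<m) (≡ᵇ-0-false (+-cancelˡ-< i 0 (invR i)
      (<-≤-trans (subst (_< f i + invL i) (sym (+-identityʳ i)) (<-≤-trans i<fi (m≤m+n (f i) _)))
        (≤-reflexive (inversions i<m)))))

    rec-antiexcedance : ∀ {i} → i < m → f i < i → rec i ≡ false
    rec-antiexcedance {i} i<m fi<i = trans (rec≡ i<m) (≡ᵇ-0-false (+-cancelˡ-< (f i) 0 (invL i)
      (<-≤-trans (subst (_< i + invR i) (sym (+-identityʳ (f i))) (<-≤-trans fi<i (m≤m+n i _)))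
        (≤-reflexive (sym (inversions i<m))))))

    invL≡invR : ∀ {i} → i < m → f i ≡ i → invL i ≡ invR i
    invL≡invR {i} i<m e = +-cancelˡ-≡ i _ _ (trans (cong (_+ invL i) (sym e)) (inversions i<m))

    unest≡ : ∀ {i} → i < f i → unest i ≡ invL i
    unest≡ {i} i<fi = count-cong i λ {j} _ → cong (_∧ (f i <ᵇ f j)) (<ᵇ-true i<fi)

    lnest≡ : ∀ {i} → f i < i → lnest i ≡ invR i
    lnest≡ {i} fi<i = count-cong m λ {l} _ → cong ((i <ᵇ l) ∧_)
      (trans (cong ((f l <ᵇ f i) ∧_) (<ᵇ-true fi<i)) (∧-identityʳ _))

    psnest≡ : ∀ {i} → f i ≡ i → psnest i ≡ invL i
    psnest≡ {i} e = cong (λ x → count i (λ j → x <ᵇ f j)) (sym e)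

    invLt≡ : ∀ {i k} → k < m → f k ≡ i → invLt i ≡ (k <ᵇ i)
    invLt≡ {i} {k} k<m refl = T-iff
      (λ t → let j , j<m , t′ = anyB⁻ m t
             in subst (λ x → T (x <ᵇ f k)) (injective j<m k<m (≡ᵇ⇒≡ (f j) (f k) (∧ˡ t′))) (∧ʳ {f j ≡ᵇ f k} t′))
      (λ t → anyB⁺ m k<m (≡⇒≡ᵇ (f k) (f k) refl & t))

    invGt≡ : ∀ {i k} → k < m → f k ≡ i → invGt i ≡ (i <ᵇ k)
    invGt≡ {i} {k} k<m refl = T-iff
      (λ t → let j , j<m , t′ = anyB⁻ m t
             in subst (λ x → T (f k <ᵇ x)) (injective j<m k<m (≡ᵇ⇒≡ (f j) (f k) (∧ˡ t′))) (∧ʳ {f j ≡ᵇ f k} t′))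
      (λ t → anyB⁺ m k<m (≡⇒≡ᵇ (f k) (f k) refl & t))

    avail : ℕ → ℕ → Bool
    avail i v = eligible m A₀ i v ∧ unhit m (earlier i) f v

    count-avail-∘ : ∀ {i} → i < m → count (f i) (avail i) ≡ count m (λ j → (f j <ᵇ f i) ∧ avail i (f j))
    count-avail-∘ {i} i<m = trans (sym (count-prefix (avail i) (<⇒≤ (bounded i<m))))
      (sym (count-∘ (λ v → (v <ᵇ f i) ∧ avail i v)))

    module Upper {i : ℕ} (i<m : i < m) (ev : isEven i ≡ true) where

      i≤fi : i ≤ f i
      i≤fi = rises i<m (≡true⇒T ev)

      -- An even `j` right of `i` has used up its value. Conversely parity need not be checked: an
      -- odd `j` with `j ≤ i ≤ f j` would satisfy `f j ≤ j`, hence equal the even `i`.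
      avail-f : ∀ {j} → j < m → avail i (f j) ≡ ((j ≤ᵇ i) ∧ (i ≤ᵇ f j))
      avail-f {j} j<m rewrite ev | <ᵇ-true (bounded j<m) | upperValues-∘ j<m = T-iff
        (λ t → ≤⇒≤ᵇ {j} {i} (≮⇒≥ λ i<j → unhit⁻ m {f = f} (∧ʳ {isEven j ∧ (i ≤ᵇ f j)} t) j<m
                 (∧ˡ {isEven j} (∧ˡ {isEven j ∧ (i ≤ᵇ f j)} t) & <⇒<ᵇ i<j) refl)
               & ∧ʳ {isEven j} (∧ˡ {isEven j ∧ (i ≤ᵇ f j)} t))
        (λ t → let j≤i = ≤ᵇ⇒≤ j i (∧ˡ t) ; i≤fj = ≤ᵇ⇒≤ i (f j) (∧ʳ {j ≤ᵇ i} t) in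
          (j-even j≤i i≤fj & ≤⇒≤ᵇ i≤fj) & unhit⁺ m {f = f} λ {k} k<m d e →
            <⇒≱ (<ᵇ⇒< i k (∧ʳ {isEven k} d)) (subst (_≤ i) (sym (injective k<m j<m e)) j≤i))
        where
        j-even : j ≤ i → i ≤ f j → T (isEven j)
        j-even j≤i i≤fj with T? (isEven j)
        ... | yes t = t
        ... | no ¬t = subst (T ∘ isEven) (≤-antisym (≤-trans i≤fj (falls j<m ¬t)) j≤i) (≡true⇒T ev)

      rank≡ : count (f i) (avail i) ≡ innL i
      rank≡ = trans (count-avail-∘ i<m) (trans (count-cong m λ {j} j<m → pointwise j<m)
        (count-prefix _ (<⇒≤ i<m)))
        where
        pointwise : ∀ {j} → j < m → ((f j <ᵇ f i) ∧ avail i (f j)) ≡ ((j <ᵇ i) ∧ ((f j <ᵇ f i) ∧ (i ≤ᵇ f j)))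
        pointwise {j} j<m rewrite avail-f j<m with <-cmp j i
        ... | tri< j<i _ _ rewrite <ᵇ-true j<i | ≤ᵇ-true (<⇒≤ j<i) = refl
        ... | tri≈ _ refl _ rewrite ≮ᵇ (≤-refl {j}) | ≮ᵇ (≤-refl {f j}) = refl
        ... | tri> _ _ i<j rewrite ≮ᵇ (<⇒≤ i<j) | ≰ᵇ i<j = ∧-zeroʳ _

      available≡ : count m (avail i) ≡ suc (innL i + invL i)
      available≡ = begin
        count m (avail i)               ≡⟨ count-∘ (avail i) ⟨
        count m (avail i ∘ f)           ≡⟨ count-cong m (λ {j} j<m → trans (avail-f j<m) (cong (_∧ (i ≤ᵇ f j)) (suc-≤ᵇ j))) ⟩
        count m (λ j → (j <ᵇ suc i) ∧ (i ≤ᵇ f j)) ≡⟨ count-prefix _ i<m ⟩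
        count i (λ j → i ≤ᵇ f j) + ⟦ i ≤ᵇ f i ⟧  ≡⟨ cong₂ _+_ (count-+ i λ {j} → split j) (cong ⟦_⟧ (≤ᵇ-true i≤fi)) ⟩
        innL i + invL i + 1              ≡⟨ +-comm _ 1 ⟩
        suc (innL i + invL i) ∎
        where
        open ≡-Reasoning
        suc-≤ᵇ : ∀ j → (j ≤ᵇ i) ≡ (j <ᵇ suc i)
        suc-≤ᵇ j = T-iff (λ t → <⇒<ᵇ (s≤s (≤ᵇ⇒≤ j i t))) (λ t → ≤⇒≤ᵇ (≤-pred (<ᵇ⇒< j (suc i) t)))
        split : ∀ j → j < i → ⟦ i ≤ᵇ f j ⟧ ≡ ⟦ (f j <ᵇ f i) ∧ (i ≤ᵇ f j) ⟧ + ⟦ f i <ᵇ f j ⟧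
        split j j<i with <-cmp (f j) (f i)
        ... | tri< lt _ _ rewrite <ᵇ-true lt | ≮ᵇ (<⇒≤ lt) = sym (+-identityʳ _)
        ... | tri≈ _ e _  = ⊥-elim (f-≢ (<-trans j<i i<m) i<m (<⇒≢ j<i) e)
        ... | tri> _ _ gt rewrite <ᵇ-true gt | ≮ᵇ (<⇒≤ gt) | ≤ᵇ-true (≤-trans i≤fi (<⇒≤ gt)) = refl

      innL-fix : f i ≡ i → innL i ≡ 0
      innL-fix e = count≡0⁺ i λ {j} _ t →
        <⇒≱ (subst (f j <_) e (<ᵇ⇒< (f j) (f i) (∧ˡ t))) (≤ᵇ⇒≤ i (f j) (∧ʳ {f j <ᵇ f i} t))

      innL-val : ∀ {k} → k < m → f k ≡ i → i < k → innL i ≡ ucross i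
      innL-val {k} k<m e i<k = count-cong i λ {j} j<i → T-iff
        (λ t → <⇒<ᵇ (≤∧≢⇒< (≤ᵇ⇒≤ i (f j) (∧ʳ {f j <ᵇ f i} t))
                 λ e′ → <⇒≢ (<-trans j<i i<k) (injective (<-trans j<i i<m) k<m (trans (sym e′) (sym e)))) & ∧ˡ t)
        (λ t → ∧ʳ {i <ᵇ f j} t & ≤⇒≤ᵇ (<⇒≤ (<ᵇ⇒< i (f j) (∧ˡ t))))

      -- The preimage `k` lies left of `i` and is counted by `innL` but not by the strict `ucross`.
      -- In `label` this is the shift by one that frees rank 0 for the fixed point.
      innL-rise : ∀ {k} → k < m → f k ≡ i → k < i → i < f i → innL i ≡ suc (ucross i)
      innL-rise {k} k<m e k<i i<fi = trans (count-remove i _ k<i)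
        (trans (cong₂ _+_ (count-cong i λ {j} j<i → others j<i)
          (cong ⟦_⟧ (T⇒≡true (<⇒<ᵇ (subst (_< f i) (sym e) i<fi) & ≤⇒≤ᵇ (≤-reflexive (sym e))))))
          (+-comm _ 1))
        where
        others : ∀ {j} → j < i → (((f j <ᵇ f i) ∧ (i ≤ᵇ f j)) ∧ not (k ≡ᵇ j)) ≡ ((i <ᵇ f j) ∧ (f j <ᵇ f i))
        others {j} j<i = T-iff
          (λ t → let t′ = ∧ˡ {(f j <ᵇ f i) ∧ (i ≤ᵇ f j)} t in
            <⇒<ᵇ (≤∧≢⇒< (≤ᵇ⇒≤ i (f j) (∧ʳ {f j <ᵇ f i} t′)) λ e′ →
              T-not⁻ (∧ʳ {(f j <ᵇ f i) ∧ (i ≤ᵇ f j)} t)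
                (≡⇒≡ᵇ k j (injective k<m (<-trans j<i i<m) (trans e e′)))) & ∧ˡ t′)
          (λ t → (∧ʳ {i <ᵇ f j} t & ≤⇒≤ᵇ (<⇒≤ (<ᵇ⇒< i (f j) (∧ˡ t)))) & T-not⁺ λ t′ →
            <⇒≢ (<ᵇ⇒< i (f j) (∧ˡ t)) (trans (sym e) (cong f (≡ᵇ⇒≡ k j t′))))

    module Lower {i : ℕ} (i<m : i < m) (od : isEven i ≡ false) where

      fi≤i : f i ≤ i
      fi≤i = falls i<m (≡false⇒¬T od)

      avail-f : ∀ {j} → j < m → avail i (f j) ≡ ((i ≤ᵇ j) ∧ (f j ≤ᵇ i))
      avail-f {j} j<m rewrite od | <ᵇ-true (bounded j<m) | upperValues-∘ j<m = T-iff
        (λ t → ≤⇒≤ᵇ {i} {j} (≮⇒≥ λ j<i → unhit⁻ m {f = f} (∧ʳ {not (isEven j) ∧ (f j ≤ᵇ i)} t) j<m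
                 (∧ˡ {not (isEven j)} (∧ˡ {not (isEven j) ∧ (f j ≤ᵇ i)} t) & <⇒<ᵇ j<i) refl)
               & ∧ʳ {not (isEven j)} (∧ˡ {not (isEven j) ∧ (f j ≤ᵇ i)} t))
        (λ t → let i≤j = ≤ᵇ⇒≤ i j (∧ˡ t) ; fj≤i = ≤ᵇ⇒≤ (f j) i (∧ʳ {i ≤ᵇ j} t) in
          (T-not⁺ (j-odd i≤j fj≤i) & ≤⇒≤ᵇ fj≤i) & unhit⁺ m {f = f} λ {k} k<m d e →
            <⇒≱ (<ᵇ⇒< k i (∧ʳ {not (isEven k)} d)) (subst (i ≤_) (sym (injective k<m j<m e)) i≤j))
        where
        j-odd : i ≤ j → f j ≤ i → ¬ T (isEven j)
        j-odd i≤j fj≤i t = ≡false⇒¬T od (subst (T ∘ isEven) (≤-antisym (≤-trans (rises j<m t) fj≤i) i≤j) t)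

      -- A value below `f i` is automatically at most `i`, so the bound in `avail-f` cuts nothing
      -- off and the rank counts nestings.
      rank≡ : count (f i) (avail i) ≡ invR i
      rank≡ = trans (count-avail-∘ i<m) (count-cong m λ {j} j<m → pointwise j<m)
        where
        pointwise : ∀ {j} → j < m → ((f j <ᵇ f i) ∧ avail i (f j)) ≡ ((i <ᵇ j) ∧ (f j <ᵇ f i))
        pointwise {j} j<m rewrite avail-f j<m = T-iff
          (λ t → let fj<fi = <ᵇ⇒< (f j) (f i) (∧ˡ t) in
            <⇒<ᵇ (≤∧≢⇒< (≤ᵇ⇒≤ i j (∧ˡ (∧ʳ {f j <ᵇ f i} t))) λ { refl → n≮n _ fj<fi }) & <⇒<ᵇ fj<fi)
          (λ t → let fj<fi = <ᵇ⇒< (f j) (f i) (∧ʳ {i <ᵇ j} t) in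
            <⇒<ᵇ fj<fi & ≤⇒≤ᵇ (<⇒≤ (<ᵇ⇒< i j (∧ˡ t))) & ≤⇒≤ᵇ (≤-trans (<⇒≤ fj<fi) fi≤i))

      available≡ : count m (avail i) ≡ suc (innR i + invR i)
      available≡ = begin
        count m (avail i)                 ≡⟨ count-∘ (avail i) ⟨
        count m (avail i ∘ f)             ≡⟨ count-cong m avail-f ⟩
        count m (λ j → (i ≤ᵇ j) ∧ (f j ≤ᵇ i)) ≡⟨ count-remove m _ i<m ⟩
        count m (λ j → ((i ≤ᵇ j) ∧ (f j ≤ᵇ i)) ∧ not (i ≡ᵇ j)) + ⟦ (i ≤ᵇ i) ∧ (f i ≤ᵇ i) ⟧
          ≡⟨ cong₂ _+_ (count-+ m λ {j} → split j) (cong ⟦_⟧ (T⇒≡true (≤⇒≤ᵇ (≤-refl {i}) & ≤⇒≤ᵇ fi≤i))) ⟩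
        innR i + invR i + 1               ≡⟨ +-comm _ 1 ⟩
        suc (innR i + invR i) ∎
        where
        open ≡-Reasoning
        split : ∀ j → j < m → ⟦ ((i ≤ᵇ j) ∧ (f j ≤ᵇ i)) ∧ not (i ≡ᵇ j) ⟧
                      ≡ ⟦ (i <ᵇ j) ∧ ((f i <ᵇ f j) ∧ (f j ≤ᵇ i)) ⟧ + ⟦ (i <ᵇ j) ∧ (f j <ᵇ f i) ⟧
        split j j<m with <-cmp i j
        ... | tri> _ _ j<i rewrite ≰ᵇ j<i | ≮ᵇ (<⇒≤ j<i) = refl
        ... | tri≈ _ refl _ rewrite T⇒≡true (≡⇒≡ᵇ i i refl) | ≮ᵇ (≤-refl {i}) = cong ⟦_⟧ (∧-zeroʳ _)
        ... | tri< i<j _ _ rewrite ≤ᵇ-true (<⇒≤ i<j) | <ᵇ-true i<j | ¬T⇒≡false (<⇒≢ i<j ∘ ≡ᵇ⇒≡ i j)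
            with <-cmp (f i) (f j)
        ...   | tri< lt _ _ rewrite <ᵇ-true lt | ≮ᵇ (<⇒≤ lt) =
                trans (cong ⟦_⟧ (∧-identityʳ (f j ≤ᵇ i))) (sym (+-identityʳ _))
        ...   | tri≈ _ e _ = ⊥-elim (f-≢ i<m j<m (<⇒≢ i<j) e)
        ...   | tri> _ _ gt rewrite <ᵇ-true gt | ≮ᵇ (<⇒≤ gt) | ≤ᵇ-true (≤-trans (<⇒≤ gt) fi≤i) = refl

      innR-fix : f i ≡ i → innR i ≡ 0
      innR-fix e = count≡0⁺ m λ {j} _ t → let t′ = ∧ʳ {i <ᵇ j} t in
        <⇒≱ (subst (_< f j) e (<ᵇ⇒< (f i) (f j) (∧ˡ t′))) (≤ᵇ⇒≤ (f j) i (∧ʳ {f i <ᵇ f j} t′))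

      innR-peak : ∀ {k} → k < m → f k ≡ i → k < i → innR i ≡ lcross i
      innR-peak {k} k<m e k<i = count-cong m λ {j} j<m → T-iff
        (λ t → let i<j = <ᵇ⇒< i j (∧ˡ t) ; t′ = ∧ʳ {i <ᵇ j} t in
          <⇒<ᵇ i<j & ∧ˡ {f i <ᵇ f j} t′ & <⇒<ᵇ (≤∧≢⇒< (≤ᵇ⇒≤ (f j) i (∧ʳ {f i <ᵇ f j} t′))
            λ e′ → <⇒≢ (<-trans k<i i<j) (injective k<m j<m (trans e (sym e′)))))
        (λ t → let t′ = ∧ʳ {i <ᵇ j} t in
          ∧ˡ {i <ᵇ j} t & ∧ˡ {f i <ᵇ f j} t′ & ≤⇒≤ᵇ (<⇒≤ (<ᵇ⇒< (f j) i (∧ʳ {f i <ᵇ f j} t′))))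

      innR-fall : ∀ {k} → k < m → f k ≡ i → i < k → f i < i → innR i ≡ suc (lcross i)
      innR-fall {k} k<m e i<k fi<i = trans (count-remove m _ k<m)
        (trans (cong₂ _+_ (count-cong m λ {j} j<m → others j<m)
          (cong ⟦_⟧ (T⇒≡true (<⇒<ᵇ i<k & <⇒<ᵇ (subst (f i <_) (sym e) fi<i) & ≤⇒≤ᵇ (≤-reflexive e)))))
          (+-comm _ 1))
        where
        others : ∀ {j} → j < m → (((i <ᵇ j) ∧ ((f i <ᵇ f j) ∧ (f j ≤ᵇ i))) ∧ not (k ≡ᵇ j))
                               ≡ ((i <ᵇ j) ∧ ((f i <ᵇ f j) ∧ (f j <ᵇ i)))
        others {j} j<m = T-iff
          (λ t → let t₁ = ∧ˡ {(i <ᵇ j) ∧ ((f i <ᵇ f j) ∧ (f j ≤ᵇ i))} t ; t₂ = ∧ʳ {i <ᵇ j} t₁ in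
            ∧ˡ {i <ᵇ j} t₁ & ∧ˡ {f i <ᵇ f j} t₂ & <⇒<ᵇ (≤∧≢⇒< (≤ᵇ⇒≤ (f j) i (∧ʳ {f i <ᵇ f j} t₂)) λ e′ →
              T-not⁻ (∧ʳ {(i <ᵇ j) ∧ ((f i <ᵇ f j) ∧ (f j ≤ᵇ i))} t)
                (≡⇒≡ᵇ k j (injective k<m j<m (trans e (sym e′))))))
          (λ t → let t₂ = ∧ʳ {i <ᵇ j} t ; fj<i = <ᵇ⇒< (f j) i (∧ʳ {f i <ᵇ f j} t₂) in
            (∧ˡ {i <ᵇ j} t & ∧ˡ {f i <ᵇ f j} t₂ & ≤⇒≤ᵇ (<⇒≤ fj<i)) & T-not⁺ λ t′ →
              <⇒≢ fj<i (trans (cong f (sym (≡ᵇ⇒≡ k j t′))) e))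

open DPermutations

-- Recovering the D-permutation and its set from availability

allB-dec : ∀ k p → T (allB k p) ⊎ ∃ λ i → i < k × p i ≡ false
allB-dec zero    p = inj₁ _
allB-dec (suc k) p with allB-dec k p | p k in e
... | inj₂ (i , i<k , pi) | _     = inj₂ (i , m<n⇒m<1+n i<k , pi)
... | inj₁ t              | true  = inj₁ (t & _)
... | inj₁ t              | false = inj₂ (k , n<1+n k , e)

availB : ℕ → (ℕ → Bool) → (ℕ → ℕ) → ℕ → ℕ → Bool
availB m A f i v = eligible m A i v ∧ unhit m (earlier i) f v

-- This limits the support of the product of factors: it can be nonzero only for D-permutations, and
-- for each of them only at its own set of upper values.
module AllAvailable {m : ℕ} {A : ℕ → Bool} {f : ℕ → ℕ}
  (ok : ∀ {i} → i < m → T (availB m A f i (f i))) where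

  private
    eligible-f : ∀ {i} → i < m → T (eligible m A i (f i))
    eligible-f i<m = ∧ˡ (ok i<m)

    bounded : ∀ {i} → i < m → f i < m
    bounded i<m = eligible-bound m A _ _ (eligible-f i<m)

    A-f : ∀ {i} → i < m → A (f i) ≡ isEven i
    A-f {i} i<m with isEven i | ∧ʳ {f i <ᵇ m} (eligible-f i<m)
    ... | true  | t = T⇒≡true (∧ˡ t)
    ... | false | t = ¬T⇒≡false (T-not⁻ (∧ˡ {not (A (f i))} t))

    rises : ∀ {i} → i < m → T (isEven i) → i ≤ f i
    rises {i} i<m ev with isEven i | ∧ʳ {f i <ᵇ m} (eligible-f i<m)
    ... | true | t = ≤ᵇ⇒≤ i (f i) (∧ʳ {A (f i)} t)

    falls : ∀ {i} → i < m → ¬ T (isEven i) → f i ≤ i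
    falls {i} i<m od with isEven i | ∧ʳ {f i <ᵇ m} (eligible-f i<m)
    ... | true  | _ = ⊥-elim (od _)
    ... | false | t = ≤ᵇ⇒≤ (f i) i (∧ʳ {not (A (f i))} t)

    fresh : ∀ {i j} → i < m → j < m → T (earlier i j) → f j ≢ f i
    fresh {i} i<m j<m d = unhit⁻ m {f = f} (∧ʳ {eligible m A i (f i)} (ok i<m)) j<m d

    ordered : ∀ i j → isEven i ≡ isEven j → i < j → T (earlier i j) ⊎ T (earlier j i)
    ordered i j same i<j with isEven i | isEven j
    ... | true  | true  = inj₁ (<⇒<ᵇ i<j)
    ... | false | false = inj₂ (<⇒<ᵇ i<j)

    distinct : ∀ {i j} → i < m → j < m → i < j → f i ≢ f j
    -- Membership of the value in `A` tells the parity of the position, so equal values force equal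
    -- parity; then one position is earlier and the other avoided its value.
    distinct {i} {j} i<m j<m i<j e with ordered i j (≡.trans (≡.sym (A-f i<m)) (≡.trans (cong A e) (A-f j<m))) i<j
    ... | inj₁ d = fresh i<m j<m d (≡.sym e)
    ... | inj₂ d = fresh j<m i<m d e

    injective : ∀ {i j} → i < m → j < m → f i ≡ f j → i ≡ j
    injective {i} {j} i<m j<m e with <-cmp i j
    ... | tri< i<j _ _ = ⊥-elim (distinct i<m j<m i<j e)
    ... | tri≈ _ i≡j _ = i≡j
    ... | tri> _ _ j<i = ⊥-elim (distinct j<m i<m j<i (≡.sym e))

  dPermutes : DPermutes m f
  dPermutes = record
    { permutes = record { bounded = bounded ; injective = injective }
    ; rises = rises
    ; falls = falls
    }

  A≡upperValues : ∀ {v} → v < m → A v ≡ upperValues m f v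
  A≡upperValues v<m with DPermutes.surjective dPermutes v<m
  ... | j , j<m , ≡.refl = ≡.trans (A-f j<m) (≡.sym (DPermutation.upperValues-∘ dPermutes j<m))

eligible-cong : ∀ m {A B : ℕ → Bool} → (∀ {v} → v < m → A v ≡ B v) → ∀ i v → eligible m A i v ≡ eligible m B i v
eligible-cong m e i v with v <ᵇ m in lt
... | false = ≡.refl
... | true rewrite e (<ᵇ⇒< v m (≡true⇒T lt)) = ≡.refl

-- The weight as a product of local factors

module Weights {c ℓ} (R : CommutativeRing c ℓ) (v : Vars R) where
  open CommutativeRing R
  open Sums R
  open Labels R
  open Steps v
  open Vars v
  open import Relation.Binary.Reasoning.Setoid setoid
  open import Algebra.Properties.CommutativeSemigroup *-commutativeSemigroup
    using () renaming (interchange to *-interchange)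

  pow-+ : ∀ x a b → pow R x (a ℕ.+ b) ≈ pow R x a * pow R x b
  pow-+ x zero    b = sym (*-identityˡ _)
  pow-+ x (suc a) b = trans (*-congˡ (pow-+ x a b)) (sym (*-assoc _ _ _))

  -- A common form for exponents given by `count` and by `sumOver`, so that one induction
  -- distributes all 22 powers over the positions.
  record Statistic : Set c where
    field
      var      : Carrier
      flag     : ℕ → Bool
      amount   : ℕ → ℕ
      sum      : ℕ → ℕ
      sum-zero : sum 0 ≡ 0
      sum-suc  : ∀ k → sum (suc k) ≡ sum k ℕ.+ (if flag k then amount k else 0)
  open Statistic

  counting : Carrier → (ℕ → Bool) → Statistic
  counting x p = record
    { var = x ; flag = p ; amount = const 1 ; sum = λ k → count k p ; sum-zero = ≡.refl ; sum-suc = λ _ → ≡.refl }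

  summing : Carrier → (ℕ → Bool) → (ℕ → ℕ) → Statistic
  summing x p g = record
    { var = x ; flag = p ; amount = g ; sum = λ k → sumN k (λ i → if p i then g i else 0) ; sum-zero = ≡.refl ; sum-suc = λ _ → ≡.refl }

  total : List Statistic → ℕ → Carrier
  total []       k = 1#
  total (s ∷ ss) k = pow R (var s) (sum s k) * total ss k

  -- Unlike with if_then_else_, a blocked test does not duplicate z, which keeps conversion checking linear.
  times-if : Bool → Carrier → Carrier → Carrier
  times-if true  y z = y * z
  times-if false y z = z

  monomial : List (Carrier × Bool × ℕ) → Carrier
  monomial []                 = 1#
  monomial ((x , b , n) ∷ es) = times-if b (pow R x n) (monomial es)

  local : List Statistic → ℕ → List (Carrier × Bool × ℕ)
  local ss k = map (λ s → var s , flag s k , amount s k) ss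

  total-zero : ∀ ss → total ss 0 ≈ 1#
  total-zero [] = refl
  total-zero (s ∷ ss) rewrite sum-zero s = trans (*-identityˡ _) (total-zero ss)

  total-suc : ∀ ss k → total ss (suc k) ≈ total ss k * monomial (local ss k)
  total-suc []       k = sym (*-identityˡ _)
  total-suc (s ∷ ss) k rewrite sum-suc s k with flag s k
  ... | false rewrite ℕₚ.+-identityʳ (sum s k) =
    trans (*-congˡ (total-suc ss k)) (sym (*-assoc _ _ _))
  ... | true =
    trans (*-cong (pow-+ (var s) (sum s k) (amount s k)) (total-suc ss k)) (*-interchange _ _ _ _)

  total-prodL : ∀ ss k → total ss k ≈ prodL (range k) (λ i → monomial (local ss i))
  total-prodL ss zero    = total-zero ss
  total-prodL ss (suc k) = trans (total-suc ss k) (trans (*-comm _ _) (*-congˡ (total-prodL ss k)))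

  total-foldl : ∀ x ss k → foldl (λ y s → y * pow R (var s) (sum s k)) x ss ≈ x * total ss k
  total-foldl x []       k = sym (*-identityʳ x)
  total-foldl x (s ∷ ss) k = trans (total-foldl _ ss k) (*-assoc _ _ _)

  exponents : (ev cp cv cr cf fx rc ar : Bool) (uc un lc ln ps : ℕ) → List (Carrier × Bool × ℕ)
  exponents ev cp cv cr cf fx rc ar uc un lc ln ps =
      (x₁ , ea ∧ cp , 1) ∷ (x₂ , ea ∧ cf , 1) ∷ (y₁ , er ∧ cv , 1) ∷ (y₂ , er ∧ cr , 1)
    ∷ (u₁ , nr ∧ cp , 1) ∷ (u₂ , nr ∧ cf , 1) ∷ (v₁ , nr ∧ cv , 1) ∷ (v₂ , nr ∧ cr , 1)
    ∷ (wₑ , not ev ∧ (fx ∧ nr) , 1) ∷ (wₒ , ev ∧ (fx ∧ nr) , 1)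
    ∷ (zₑ , not ev ∧ (rc ∧ ar) , 1) ∷ (zₒ , ev ∧ (rc ∧ ar) , 1)
    ∷ (p₋₁ , cp , lc) ∷ (p₋₂ , cf , lc) ∷ (p₊₁ , cv , uc) ∷ (p₊₂ , cr , uc)
    ∷ (q₋₁ , cp , ln) ∷ (q₋₂ , cf , ln) ∷ (q₊₁ , cv , un) ∷ (q₊₂ , cr , un)
    ∷ (sₑ , not ev ∧ fx , ps) ∷ (sₒ , ev ∧ fx , ps) ∷ []
    where
    ea er nr : Bool
    ea = ar ∧ not rc
    er = rc ∧ not ar
    nr = not rc ∧ not ar

  opaque
    -- Opaque, so that unification solves for its arguments instead of unfolding the product.
    contribution : (ev cp cv cr cf fx rc ar : Bool) (uc un lc ln ps : ℕ) → Carrier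
    contribution ev cp cv cr cf fx rc ar uc un lc ln ps = monomial (exponents ev cp cv cr cf fx rc ar uc un lc ln ps)

  contribution-cong : ∀ {ev ev′ cp cp′ cv cv′ cr cr′ cf cf′ fx fx′ rc rc′ ar ar′ uc lc un un′ ln ln′ ps ps′} →
    ev ≡ ev′ → cp ≡ cp′ → cv ≡ cv′ → cr ≡ cr′ → cf ≡ cf′ → fx ≡ fx′ → rc ≡ rc′ → ar ≡ ar′ →
    un ≡ un′ → ln ≡ ln′ → ps ≡ ps′ →
    contribution ev cp cv cr cf fx rc ar uc un lc ln ps ≡ contribution ev′ cp′ cv′ cr′ cf′ fx′ rc′ ar′ uc un′ lc ln′ ps′
  contribution-cong ≡.refl ≡.refl ≡.refl ≡.refl ≡.refl ≡.refl ≡.refl ≡.refl ≡.refl ≡.refl ≡.refl = ≡.refl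

  -- The left side is the shape to which `monomial` reduces once all flags are known; the trailing
  -- ones come from `pow` with exponent one and from the end of the list.
  arc-product : ∀ y P Q → (y * 1#) * (P * (Q * 1#)) ≈ P * Q * y
  arc-product y P Q = trans (*-cong (*-identityʳ y) (*-congˡ (*-identityʳ Q))) (*-comm _ _)

  fixed-product : ∀ w P → (w * 1#) * (P * 1#) ≈ P * w
  fixed-product w P = trans (*-cong (*-identityʳ w) (*-identityʳ P)) (*-comm _ _)

  unit-product : ∀ z → (z * 1#) * (1# * 1#) ≈ z
  unit-product z = trans (fixed-product z 1#) (*-identityˡ z)

  opaque
    unfolding contribution

    contribution-val : ∀ {uc lc ln ps} un →
      contribution true false true false false false (un ≡ᵇ 0) false uc un lc ln ps ≈ arc p₊₁ q₊₁ y₁ v₁ uc un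
    contribution-val zero    = arc-product _ _ _
    contribution-val (suc _) = arc-product _ _ _

    contribution-rise : ∀ {uc lc ln ps} un →
      contribution true false false true false false (un ≡ᵇ 0) false uc un lc ln ps ≈ arc p₊₂ q₊₂ y₂ v₂ uc un
    contribution-rise zero    = arc-product _ _ _
    contribution-rise (suc _) = arc-product _ _ _

    contribution-peak : ∀ {uc un lc ps} ln →
      contribution false true false false false false false (ln ≡ᵇ 0) uc un lc ln ps ≈ arc p₋₁ q₋₁ x₁ u₁ lc ln
    contribution-peak zero    = arc-product _ _ _
    contribution-peak (suc _) = arc-product _ _ _

    contribution-fall : ∀ {uc un lc ps} ln →
      contribution false false false false true false false (ln ≡ᵇ 0) uc un lc ln ps ≈ arc p₋₂ q₋₂ x₂ u₂ lc ln
    contribution-fall zero    = arc-product _ _ _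
    contribution-fall (suc _) = arc-product _ _ _

    contribution-oddfix : ∀ {uc un lc ln} ps →
      contribution true false false false false true (ps ≡ᵇ 0) (ps ≡ᵇ 0) uc un lc ln ps ≈ fixed upper ps
    contribution-oddfix zero    = unit-product _
    contribution-oddfix (suc _) = fixed-product _ _

    contribution-evenfix : ∀ {uc un lc ln} ps →
      contribution false false false false false true (ps ≡ᵇ 0) (ps ≡ᵇ 0) uc un lc ln ps ≈ fixed lower ps
    contribution-evenfix zero    = unit-product _
    contribution-evenfix (suc _) = fixed-product _ _

  module _ (m : ℕ) (f : ℕ → ℕ) where
    open Perm m f

    statistics : List Statistic
    statistics =
        counting x₁ (λ i → earec i ∧ cpeak i) ∷ counting x₂ (λ i → earec i ∧ cdfall i)
      ∷ counting y₁ (λ i → erec i ∧ cval i) ∷ counting y₂ (λ i → erec i ∧ cdrise i)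
      ∷ counting u₁ (λ i → nr i ∧ cpeak i) ∷ counting u₂ (λ i → nr i ∧ cdfall i)
      ∷ counting v₁ (λ i → nr i ∧ cval i) ∷ counting v₂ (λ i → nr i ∧ cdrise i)
      ∷ counting wₑ (λ i → evenIdx i ∧ (fix i ∧ nr i)) ∷ counting wₒ (λ i → oddIdx i ∧ (fix i ∧ nr i))
      ∷ counting zₑ (λ i → evenIdx i ∧ rar i) ∷ counting zₒ (λ i → oddIdx i ∧ rar i)
      ∷ summing p₋₁ cpeak lcross ∷ summing p₋₂ cdfall lcross ∷ summing p₊₁ cval ucross ∷ summing p₊₂ cdrise ucross
      ∷ summing q₋₁ cpeak lnest ∷ summing q₋₂ cdfall lnest ∷ summing q₊₁ cval unest ∷ summing q₊₂ cdrise unest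
      ∷ summing sₑ (λ i → evenIdx i ∧ fix i) psnest ∷ summing sₒ (λ i → oddIdx i ∧ fix i) psnest ∷ []

    localWeight : ℕ → Carrier
    localWeight i = contribution (isEven i) (cpeak i) (cval i) (cdrise i) (cdfall i) (fix i) (rec i) (arec i)
                                 (ucross i) (unest i) (lcross i) (lnest i) (psnest i)

    opaque
      unfolding contribution

      weight-localWeight : weight R v m f ≈ prodL (range m) localWeight
      -- `weight` is a left-nested product, hence a `foldl` starting from its first power; that is
      -- why the first statistic is dropped from the list.
      weight-localWeight = trans (total-foldl _ (drop 1 statistics) m) (total-prodL statistics m)

  module _ {m : ℕ} {f : ℕ → ℕ} (dp : DPermutes m f) where
    open DPermutes dp
    open DPermutation dp
    open Perm m f

    private A₀ = upperValues m f

    classified : ∀ {i k lt gt below above fx rc ar un ln ps} ev → k < m → f k ≡ i → isEven i ≡ ev →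
      (k <ᵇ i) ≡ lt → (i <ᵇ k) ≡ gt → (f i <ᵇ i) ≡ below → (i <ᵇ f i) ≡ above → (f i ≡ᵇ i) ≡ fx →
      rec i ≡ rc → arec i ≡ ar → unest i ≡ un → lnest i ≡ ln → psnest i ≡ ps →
      localWeight m f i ≡
        contribution ev (lt ∧ below) (gt ∧ above) (lt ∧ above) (gt ∧ below) fx rc ar (ucross i) un (lcross i) ln ps
    classified {i} ev k<m e ev≡ lt≡ gt≡ below≡ above≡ fx≡ rc≡ ar≡ un≡ ln≡ ps≡ =
      contribution-cong ev≡ (cong₂ _∧_ l below≡) (cong₂ _∧_ g above≡) (cong₂ _∧_ l above≡) (cong₂ _∧_ g below≡)
        fx≡ rc≡ ar≡ un≡ ln≡ ps≡
      where
      l = ≡.trans (invLt≡ k<m e) lt≡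
      g = ≡.trans (invGt≡ k<m e) gt≡

    ≢ᵇ : ∀ {a b} → a ≢ b → (a ≡ᵇ b) ≡ false
    ≢ᵇ {a} {b} a≢b = ¬T⇒≡false (a≢b ∘ ≡ᵇ⇒≡ a b)

    ≡ᵇ-true : ∀ {a b} → a ≡ b → (a ≡ᵇ b) ≡ true
    ≡ᵇ-true {a} {b} e = T⇒≡true (≡⇒≡ᵇ a b e)

    n≮ᵇn : ∀ {a b} → a ≡ b → (a <ᵇ b) ≡ false
    n≮ᵇn {a} ≡.refl = ≮ᵇ (≤-refl {a})

    -- Everything depends on where the preimage `k` of `i` lies: at `i` for a fixed point, left for
    -- a cycle double rise, right for a cycle valley. The same comparison decides whether `i`
    -- belongs to `A₀`, the flag of `label`.
    upper-weight : ∀ {i} → i < m → isEven i ≡ true →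
      localWeight m f i ≈ label upper (A₀ i) (suc (innL i ℕ.+ invL i)) (innL i)
    upper-weight {i} i<m ev = let k , k<m , e = surjective i<m in go k<m e (<-cmp k i)
      where
      open Upper i<m ev
      go : ∀ {k} → k < m → f k ≡ i → Tri (k < i) (k ≡ i) (i < k) →
        localWeight m f i ≈ label upper (A₀ i) (suc (innL i ℕ.+ invL i)) (innL i)
      go k<m e (tri≈ _ ≡.refl _) = begin
        localWeight m f i
          ≡⟨ classified true k<m e ev (n≮ᵇn {i} ≡.refl) (n≮ᵇn {i} ≡.refl) (n≮ᵇn e) (n≮ᵇn (≡.sym e)) (≡ᵇ-true e)
               (rec≡ i<m) (≡.trans (arec≡ i<m) (cong (_≡ᵇ 0) (≡.sym (invL≡invR i<m e)))) ≡.refl ≡.refl (psnest≡ e) ⟩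
        contribution true false false false false true (invL i ≡ᵇ 0) (invL i ≡ᵇ 0) _ _ _ _ (invL i)
          ≈⟨ contribution-oddfix (invL i) ⟩
        fixed upper (invL i)
          ≡⟨ cong₂ (λ b r → label upper b (suc (r ℕ.+ invL i)) r)
               (≡.trans (cong A₀ (≡.sym e)) (≡.trans (upperValues-∘ i<m) ev)) (innL-fix e) ⟨
        label upper (A₀ i) (suc (innL i ℕ.+ invL i)) (innL i) ∎
      go k<m e (tri< k<i k≢i _) = begin
        localWeight m f i
          ≡⟨ classified true k<m e ev (<ᵇ-true k<i) (≮ᵇ (ℕₚ.<⇒≤ k<i)) (≮ᵇ i≤fi) (<ᵇ-true i<fi) (≢ᵇ (<⇒≢ i<fi ∘ ≡.sym))
               (rec≡ i<m) (arec-excedance i<m i<fi) (unest≡ i<fi) ≡.refl ≡.refl ⟩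
        contribution true false false true false false (invL i ≡ᵇ 0) false _ (invL i) _ _ _
          ≈⟨ contribution-rise (invL i) ⟩
        arc p₊₂ q₊₂ y₂ v₂ (ucross i) (invL i)
          ≡⟨ cong (arc p₊₂ q₊₂ y₂ v₂ (ucross i)) (m+n∸m≡n (ucross i) (invL i)) ⟨
        label upper true (suc (suc (ucross i) ℕ.+ invL i)) (suc (ucross i))
          ≡⟨ cong₂ (λ b r → label upper b (suc (r ℕ.+ invL i)) r) (upperValues-left k<m e k<i) (innL-rise k<m e k<i i<fi) ⟨
        label upper (A₀ i) (suc (innL i ℕ.+ invL i)) (innL i) ∎
        where
        i<fi : i < f i
        i<fi = ≤∧≢⇒< i≤fi λ e′ → k≢i (injective k<m i<m (≡.trans e e′))
      go k<m e (tri> _ k≢i i<k) = begin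
        localWeight m f i
          ≡⟨ classified true k<m e ev (≮ᵇ (ℕₚ.<⇒≤ i<k)) (<ᵇ-true i<k) (≮ᵇ i≤fi) (<ᵇ-true i<fi) (≢ᵇ (<⇒≢ i<fi ∘ ≡.sym))
               (rec≡ i<m) (arec-excedance i<m i<fi) (unest≡ i<fi) ≡.refl ≡.refl ⟩
        contribution true false true false false false (invL i ≡ᵇ 0) false _ (invL i) _ _ _
          ≈⟨ contribution-val (invL i) ⟩
        arc p₊₁ q₊₁ y₁ v₁ (ucross i) (invL i)
          ≡⟨ cong (arc p₊₁ q₊₁ y₁ v₁ (ucross i)) (m+n∸m≡n (ucross i) (invL i)) ⟨
        label upper false (suc (ucross i ℕ.+ invL i)) (ucross i)
          ≡⟨ cong₂ (λ b r → label upper b (suc (r ℕ.+ invL i)) r) (upperValues-right k<m e i<k) (innL-val k<m e i<k) ⟨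
        label upper (A₀ i) (suc (innL i ℕ.+ invL i)) (innL i) ∎
        where
        i<fi : i < f i
        i<fi = ≤∧≢⇒< i≤fi λ e′ → k≢i (injective k<m i<m (≡.trans e e′))

    lower-weight : ∀ {i} → i < m → isEven i ≡ false →
      localWeight m f i ≈ label lower (not (A₀ i)) (suc (innR i ℕ.+ invR i)) (innR i)
    lower-weight {i} i<m od = let k , k<m , e = surjective i<m in go k<m e (<-cmp k i)
      where
      open Lower i<m od
      go : ∀ {k} → k < m → f k ≡ i → Tri (k < i) (k ≡ i) (i < k) →
        localWeight m f i ≈ label lower (not (A₀ i)) (suc (innR i ℕ.+ invR i)) (innR i)
      go k<m e (tri≈ _ ≡.refl _) = begin
        localWeight m f i
          ≡⟨ classified false k<m e od (n≮ᵇn {i} ≡.refl) (n≮ᵇn {i} ≡.refl) (n≮ᵇn e) (n≮ᵇn (≡.sym e)) (≡ᵇ-true e)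
               (≡.trans (rec≡ i<m) (cong (_≡ᵇ 0) (invL≡invR i<m e))) (arec≡ i<m) ≡.refl ≡.refl
               (≡.trans (psnest≡ e) (invL≡invR i<m e)) ⟩
        contribution false false false false false true (invR i ≡ᵇ 0) (invR i ≡ᵇ 0) _ _ _ _ (invR i)
          ≈⟨ contribution-evenfix (invR i) ⟩
        fixed lower (invR i)
          ≡⟨ cong₂ (λ b r → label lower (not b) (suc (r ℕ.+ invR i)) r)
               (≡.trans (cong A₀ (≡.sym e)) (≡.trans (upperValues-∘ i<m) od)) (innR-fix e) ⟨
        label lower (not (A₀ i)) (suc (innR i ℕ.+ invR i)) (innR i) ∎
      go k<m e (tri< k<i k≢i _) = begin
        localWeight m f i
          ≡⟨ classified false k<m e od (<ᵇ-true k<i) (≮ᵇ (ℕₚ.<⇒≤ k<i)) (<ᵇ-true fi<i) (≮ᵇ fi≤i) (≢ᵇ (<⇒≢ fi<i))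
               (rec-antiexcedance i<m fi<i) (arec≡ i<m) ≡.refl (lnest≡ fi<i) ≡.refl ⟩
        contribution false true false false false false false (invR i ≡ᵇ 0) _ _ _ (invR i) _
          ≈⟨ contribution-peak (invR i) ⟩
        arc p₋₁ q₋₁ x₁ u₁ (lcross i) (invR i)
          ≡⟨ cong (arc p₋₁ q₋₁ x₁ u₁ (lcross i)) (m+n∸m≡n (lcross i) (invR i)) ⟨
        label lower false (suc (lcross i ℕ.+ invR i)) (lcross i)
          ≡⟨ cong₂ (λ b r → label lower (not b) (suc (r ℕ.+ invR i)) r) (upperValues-left k<m e k<i) (innR-peak k<m e k<i) ⟨
        label lower (not (A₀ i)) (suc (innR i ℕ.+ invR i)) (innR i) ∎
        where
        fi<i : f i < i
        fi<i = ≤∧≢⇒< fi≤i λ e′ → k≢i (injective k<m i<m (≡.trans e (≡.sym e′)))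
      go k<m e (tri> _ k≢i i<k) = begin
        localWeight m f i
          ≡⟨ classified false k<m e od (≮ᵇ (ℕₚ.<⇒≤ i<k)) (<ᵇ-true i<k) (<ᵇ-true fi<i) (≮ᵇ fi≤i) (≢ᵇ (<⇒≢ fi<i))
               (rec-antiexcedance i<m fi<i) (arec≡ i<m) ≡.refl (lnest≡ fi<i) ≡.refl ⟩
        contribution false false false false true false false (invR i ≡ᵇ 0) _ _ _ (invR i) _
          ≈⟨ contribution-fall (invR i) ⟩
        arc p₋₂ q₋₂ x₂ u₂ (lcross i) (invR i)
          ≡⟨ cong (arc p₋₂ q₋₂ x₂ u₂ (lcross i)) (m+n∸m≡n (lcross i) (invR i)) ⟨
        label lower true (suc (suc (lcross i) ℕ.+ invR i)) (suc (lcross i))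
          ≡⟨ cong₂ (λ b r → label lower (not b) (suc (r ℕ.+ invR i)) r) (upperValues-right k<m e i<k) (innR-fall k<m e i<k fi<i) ⟨
        label lower (not (A₀ i)) (suc (innR i ℕ.+ invR i)) (innR i) ∎
        where
        fi<i : f i < i
        fi<i = ≤∧≢⇒< fi≤i λ e′ → k≢i (injective k<m i<m (≡.trans e (≡.sym e′)))

    available-value : ∀ {i} → i < m → avail i (f i) ≡ true →
      Fill.factor m A₀ i f ≡ rank-weight A₀ i (count m (avail i)) (count (f i) (avail i))
    available-value i<m e rewrite e = ≡.refl

    local-factor : ∀ {i} → i < m → localWeight m f i ≈ Fill.factor m A₀ i f
    local-factor {i} i<m = go (isEven i) ≡.refl
      where
      go : ∀ b → isEven i ≡ b → localWeight m f i ≈ Fill.factor m A₀ i f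
      go true par = begin
        localWeight m f i
          ≈⟨ upper-weight i<m par ⟩
        label upper (A₀ i) (suc (innL i ℕ.+ invL i)) (innL i)
          ≡⟨ cong₂ (label upper (A₀ i)) available≡ rank≡ ⟨
        label upper (A₀ i) (count m (avail i)) (count (f i) (avail i))
          ≡⟨ cong (λ b → if b then label upper (A₀ i) N r else label lower (not (A₀ i)) N (N ∸ 1 ∸ r)) par ⟨
        rank-weight A₀ i N r
          ≡⟨ available-value i<m (≡.trans (avail-f i<m) (T⇒≡true (≤⇒≤ᵇ (≤-refl {i}) & ≤⇒≤ᵇ i≤fi))) ⟨
        Fill.factor m A₀ i f ∎
        where
        open Upper i<m par
        N = count m (avail i)
        r = count (f i) (avail i)
      go false par = begin
        localWeight m f i
          ≈⟨ lower-weight i<m par ⟩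
        label lower (not (A₀ i)) (suc (innR i ℕ.+ invR i)) (innR i)
          -- The label is indexed by `innR i`, while the rank of the chosen value is `invR i`; the
          -- two are complementary among the available values other than `f i`.
          ≡⟨ cong (label lower (not (A₀ i)) (suc (innR i ℕ.+ invR i))) (ℕₚ.m+n∸n≡m (innR i) (invR i)) ⟨
        label lower (not (A₀ i)) (suc (innR i ℕ.+ invR i)) (innR i ℕ.+ invR i ∸ invR i)
          ≡⟨ cong₂ (λ N r → label lower (not (A₀ i)) N (N ∸ 1 ∸ r)) available≡ rank≡ ⟨
        label lower (not (A₀ i)) N (N ∸ 1 ∸ r)
          ≡⟨ cong (λ b → if b then label upper (A₀ i) N r else label lower (not (A₀ i)) N (N ∸ 1 ∸ r)) par ⟨
        rank-weight A₀ i N r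
          ≡⟨ available-value i<m (≡.trans (avail-f i<m) (T⇒≡true (≤⇒≤ᵇ (≤-refl {i}) & ≤⇒≤ᵇ fi≤i))) ⟨
        Fill.factor m A₀ i f ∎
        where
        open Lower i<m par
        N = count m (avail i)
        r = count (f i) (avail i)

    weight-factor : weight R v m f ≈ prodL (range m) (λ i → Fill.factor m A₀ i f)
    weight-factor = trans (weight-localWeight m f)
      (prodL-cong (range m) λ i∈ → local-factor (∈-range⁻ m i∈))

  -- Exchanging the sums over functions and sets

  factors : ℕ → (ℕ → Bool) → (ℕ → ℕ) → Carrier
  factors m A f = prodL (range m) (λ i → Fill.factor m A i f)

  factors-ext : ∀ m A → Extensional (factors m A)
  factors-ext m A e = prodL-cong (range m) λ {i} _ → Fill.factor-ext m A i e

  factors-cong : ∀ m {A B f} → AgreeBelow m A B → factors m A f ≈ factors m B f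
  factors-cong m {A} {B} {f} agree = prodL-cong (range m) λ {i} i∈ → reflexive (same (∈-range⁻ m i∈))
    where
    avail≗ : ∀ i → availB m A f i ≗ availB m B f i
    avail≗ i u = cong (_∧ unhit m (earlier i) f u) (eligible-cong m agree i u)
    same : ∀ {i} → i < m → Fill.factor m A i f ≡ Fill.factor m B i f
    same {i} i<m
      rewrite avail≗ i (f i)
            | count-cong m {availB m A f i} {availB m B f i} (λ {u} _ → avail≗ i u)
            | count-cong (f i) {availB m A f i} {availB m B f i} (λ {u} _ → avail≗ i u)
            | agree i<m = ≡.refl

  factors-vanish : ∀ m A f → (factors m A f ≈ 0#) ⊎ (∀ {i} → i < m → T (availB m A f i (f i)))
  factors-vanish m A f with allB-dec m (λ i → availB m A f i (f i))
  ... | inj₁ t = inj₂ (allB⁻ m t)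
  ... | inj₂ (i , i<m , e) = inj₁ (prodL-0 (∈-range⁺ m i<m) (reflexive zero-factor))
    where
    zero-factor : Fill.factor m A i f ≡ 0#
    zero-factor rewrite e = ≡.refl

  -- The number of elements of `A` still ahead is known from those already passed only if `A` has
  -- `n` elements. As the sum runs over all sets, this condition is carried along as a factor.
  balance : ℕ → ℕ → Carrier
  balance n a = if a ≡ᵇ n then 1# else 0#

  isD-weight : ∀ n f → (if Perm.isD (dbl n) f then weight R v (dbl n) f else 0#)
    ≈ sumB (dbl n) (λ A → balance n (count (dbl n) A) * factors (dbl n) A f)
  isD-weight n f = go (Perm.isD (dbl n) f) ≡.refl
    where
    go : ∀ b → Perm.isD (dbl n) f ≡ b → (if b then weight R v (dbl n) f else 0#)
      ≈ sumB (dbl n) (λ A → balance n (count (dbl n) A) * factors (dbl n) A f)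
    go true isD = begin
      weight R v m f ≈⟨ weight-factor dp ⟩
      factors m A₀ f ≈⟨ *-identityˡ _ ⟨
      1# * factors m A₀ f ≡⟨ cong (λ b → (if b then 1# else 0#) * factors m A₀ f) (T⇒≡true (≡⇒≡ᵇ (count m A₀) n balanced)) ⟨
      balance n (count m A₀) * factors m A₀ f
        ≈⟨ sumB-singleton m A₀
             (λ agree → *-cong (reflexive (cong (balance n) (count-cong m agree))) (factors-cong m agree)) off ⟨
      sumB m (λ A → balance n (count m A) * factors m A f) ∎
      where
      m = dbl n
      dp : DPermutes m f
      dp = isD⁻ (≡true⇒T isD)
      A₀ = upperValues m f
      balanced : count m A₀ ≡ n
      balanced = ≡.trans (DPermutation.count-upperValues dp) (count-even n)
      off : ∀ A → (balance n (count m A) * factors m A f ≈ 0#) ⊎ AgreeBelow m A A₀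
      off A with factors-vanish m A f
      ... | inj₁ z  = inj₁ (trans (*-congˡ z) (zeroʳ _))
      ... | inj₂ ok = inj₂ (AllAvailable.A≡upperValues {m} {A} {f} ok)
    go false isD = sym (sumB-0 (dbl n) vanish)
      where
      vanish : ∀ A → balance n (count (dbl n) A) * factors (dbl n) A f ≈ 0#
      vanish A with factors-vanish (dbl n) A f
      ... | inj₁ z  = trans (*-congˡ z) (zeroʳ _)
      ... | inj₂ ok = ⊥-elim (≡false⇒¬T isD (isD⁺ (AllAvailable.dPermutes {dbl n} {A} {f} ok)))

  sum-factors : ∀ n A → let m = dbl n in
    sumF m (range m) (const 0) (λ f → balance n (count m A) * factors m A f)
    ≈ prodL (range m) (λ i → step i (A i) (count i A)) * balance n (count m A)
  sum-factors n A = begin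
    sumF m (range m) (const 0) (λ f → balance n (count m A) * factors m A f)
      ≈⟨ sumF-*ˡ m (range m) (λ _ _ → refl) ⟩
    balance n (count m A) * sumF m (range m) (const 0) (factors m A)
      ≈⟨ *-congˡ (sumF-↭ m (↭-sym (order-↭ n)) (factors-ext m A) (const 0)) ⟩
    balance n (count m A) * sumF m (order n) (const 0) (factors m A)
      ≈⟨ *-congˡ (sumF-cong m (order n) λ _ → prodL-↭ (↭-sym (order-↭ n))) ⟩
    balance n (count m A) * sumF m (order n) (const 0) (λ f → prodL (order n) (λ i → Fill.factor m A i f))
      -- At the start every position is open, so closedness and the condition on filled positions
      -- are vacuous.
      ≈⟨ *-congˡ (Fill.fill m A (order n) (order-earlier n)
           (λ _ j<m j∉ → ⊥-elim (j∉ (all j<m))) (λ j<m j∉ → ⊥-elim (j∉ (all j<m)))) ⟩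
    balance n (count m A) * prodL (order n) (Fill.total m A)
      ≈⟨ *-congˡ (prodL-↭ (order-↭ n)) ⟩
    balance n (count m A) * prodL (range m) (Fill.total m A)
      ≈⟨ trans balanced-steps (*-comm _ _) ⟩
    prodL (range m) (λ i → step i (A i) (count i A)) * balance n (count m A) ∎
    where
    m = dbl n
    all : ∀ {j} → j < m → j ∈ order n
    all j<m = ↭ₚ.∈-resp-↭ (↭-sym (order-↭ n)) (∈-range⁺ m j<m)
    balanced-steps : balance n (count m A) * prodL (range m) (Fill.total m A)
                   ≈ balance n (count m A) * prodL (range m) (λ i → step i (A i) (count i A))
    balanced-steps with count m A ≡ᵇ n in e
    ... | false = trans (zeroˡ _) (sym (zeroˡ _))
    ... | true  = *-congˡ (prodL-cong (range m) λ i∈ →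
                    total-step n A (∈-range⁻ m i∈) (≡ᵇ⇒≡ (count m A) n (≡true⇒T e)))

  P-Tfrac : ∀ n → sumList R (map (λ l → if Perm.isD (dbl n) (at l) then weight R v (dbl n) (at l) else 0#)
                                 (allLists (dbl n) (dbl n)))
                  ≈ Tfrac R (α R v) (δ R v) n
  P-Tfrac n = begin
    sumList R (map (λ l → if Perm.isD m (at l) then weight R v m (at l) else 0#) (allLists m m))
      ≈⟨ sumList-map-cong (allLists m m) (λ l → isD-weight n (at l)) ⟩
    sumList R (map (λ l → sumB m (λ A → g A (at l))) (allLists m m))
      ≈⟨ sumList-allLists-at m m (λ e → sumB-cong m λ A → *-congˡ (factors-ext m A e)) ⟩
    sumF m (range m) (const 0) (λ f → sumB m (λ A → g A f))
      ≈⟨ sumF-sumB m (range m) m ⟩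
    sumB m (λ A → sumF m (range m) (const 0) (g A))
      ≈⟨ sumB-cong m (sum-factors n) ⟩
    sumB m (λ A → prodL (range m) (λ i → step i (A i) (count i A)) * balance n (count m A))
      ≈⟨ paths-Tfrac n ⟩
    Tfrac R (α R v) (δ R v) n ∎
    where
    m = dbl n
    g : (ℕ → Bool) → (ℕ → ℕ) → Carrier
    g A f = balance n (count m A) * factors m A f

theorem3p9 : ∀ {c ℓ} (R : CommutativeRing c ℓ) (v : Vars R) (n : ℕ) →
    CommutativeRing._≈_ R (P R v n) (Tfrac R (α R v) (δ R v) n)
theorem3p9 R v n = subst
  (λ m → sumList R (map (λ l → if Perm.isD m (at l) then weight R v m (at l) else 0#) (allLists m m)) ≈ Tfrac R (α R v) (δ R v) n)
  (dbl≡ n) (Weights.P-Tfrac R v n)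
  where open CommutativeRing R using (0#; _≈_)
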